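{- Let $C_n(x)$ denote the second-order Eulerian polynomials, let $C(x;z)=\sum_{n\geqslant 0}C_n(x)\frac{z^n}{n!}$, and define $L_n^{C}(x)$, $n\geqslant 1$, by $$\sum_{n\geqslant 1}L_n^{C}(x)\frac{z^n}{n!}=\frac{\partial}{\partial x}\ln C(x;z).$$ Then for every $n\geqslant 1$ the following identities of $n\times n$ determinants hold: $$\frac{\mathrm{d}}{\mathrm{d}x} C_n(x)= \begin{vmatrix} L_1^{C}(x) & -1 & 0 & \cdots & 0\\ L_2^{C}(x) & 2x & -1 & \cdots & 0\\ L_3^{C}(x) & 3C_1(x) & 3x & \cdots & 0\\ \vdots & \vdots & \vdots & \ddots & -1\\ L_n^{C}(x) & \binom n1C_{n-2}(x) & \binom n2C_{n-3}(x) & \cdots & \binom n{n-1}x \end{vmatrix},$$ and $L_n^C(x)$ can be computed by $$L_n^{C}(x)= \begin{vmatrix} 1 & -1 & 0 & \cdots & 0\\ \frac{\mathrm{d}}{\mathrm{d}x} C_1(x) & 2x & -1 & \cdots & 0\\ \frac{\mathrm{d}}{\mathrm{d}x} C_2(x) & 3C_1(x) & 3x & \cdots & 0\\ \vdots & \vdots & \vdots & \ddots & -1\\ \frac{\mathrm{d}}{\mathrm{d}x} C_{n-1}(x) & \binom n1C_{n-2}(x) & \binom n2C_{n-3}(x) & \cdots & \binom n{n-1}x \end{vmatrix}.$$ In both matrices, the $(i,i)$ entry is $\binom{i}{i-1}x$ for $2\leqslant i\leqslant n$, the $(i,j)$ entry is $\binom{i}{j-1}C_{i-j}(x)$ for $2\leqslant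 j<i\leqslant n$, the $(i,i+1)$ entries are $-1$, and the $(i,j)$ entries with $j>i+1$ are $0$. The $(i,1)$ entry of the first matrix is $L_i^C(x)$ for $1\leqslant i\leqslant n$; in the second matrix the $(1,1)$ entry is $1$ and the $(i,1)$ entry is $\frac{\mathrm{d}}{\mathrm{d}x}C_{i-1}(x)$ for $2\leqslant i\leqslant n$.
   Context: The second-order Eulerian polynomials $C_n(x)$ are defined by $C_0(x)=1$ and $C_n(x)=(2n-1)xC_{n-1}(x)+x(1-x)\frac{\mathrm{d}}{\mathrm{d}x}C_{n-1}(x)$ for $n\geqslant 1$; thus $C_1(x)=x$, $C_2(x)=x+2x^2$, $C_3(x)=x+8x^2+6x^3$. Equivalently, $C_n(x)=\sum_{\sigma}x^{\mathrm{des}(\sigma)}$, the sum being over all Stirling permutations $\sigma=\sigma_1\cdots\sigma_{2n}$ of the multiset $\{1,1,2,2,\ldots,n,n\}$ (arrangements in which, for each $i$, all letters between the two occurrences of $i$ are at least $i$), where $\mathrm{des}(\sigma)$ is the number of indices $i\in\{0,1,\ldots,2n\}$ with $\sigma_i>\sigma_{i+1}$, with $\sigma_0=\sigma_{2n+1}=0$. Generating functions are formal power series in $z$ with coefficients polynomials in $x$, and $\frac{\partial}{\partial x}\ln C(x;z)$ means $\left(\frac{\partial}{\partial x}C(x;z)\right)/C(x;z)$. -}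

module Defs where

open import Algebra.Bundles using (RawRing)
import Algebra.Definitions.RawSemiring as RawSemiringDefs
open import Data.Fin.Base using (Fin; zero; suc; toℕ; punchIn)
open import Data.Integer.Base as ℤ using (+_)
open import Data.List.Base using (List; []; _∷_; map)
open import Data.Nat.Base as ℕ using (ℕ; zero; suc; _∸_; _!; NonZero; less; equal; greater)
open import Data.Nat.Combinatorics using () renaming (_C_ to _choose_)
open import Data.Nat.Properties using (_!≢0)
open import Data.Rational.Base as ℚ using (ℚ)
import Data.Rational.Properties as ℚ
import Data.Rational.Unnormalised.Base as ℚᵘ
import Data.Rational.Unnormalised.Properties as ℚᵘ
import Data.Integer.Properties as ℤ
import Data.Vec.Functional as Vector
open import Relation.Binary.PropositionalEquality
  using (_≡_; refl; sym; trans; cong; cong₂; module ≡-Reasoning)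

module Polynomial {c ℓ} (R : RawRing c ℓ) where
  open RawRing R
  open RawSemiringDefs rawSemiring using (_×_)

  -- a₀ ∷ a₁ ∷ … ∷ [] is a₀ + a₁ x + …; trailing zeros are allowed, so
  -- polynomials are compared by coefficients (_≈ₚ_), not by _≡_.
  Poly : Set c
  Poly = List Carrier

  coeff : Poly → ℕ → Carrier
  coeff []      _       = 0#
  coeff (a ∷ p) zero    = a
  coeff (a ∷ p) (suc k) = coeff p k

  infix 4 _≈ₚ_
  _≈ₚ_ : Poly → Poly → Set ℓ
  p ≈ₚ q = ∀ k → coeff p k ≈ coeff q k

  infixl 6 _+ₚ_
  _+ₚ_ : Poly → Poly → Poly
  []      +ₚ q       = q
  (a ∷ p) +ₚ []      = a ∷ p
  (a ∷ p) +ₚ (b ∷ q) = (a + b) ∷ (p +ₚ q)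

  scale : Carrier → Poly → Poly
  scale a = map (a *_)

  infixl 7 _*ₚ_
  _*ₚ_ : Poly → Poly → Poly
  []      *ₚ q = []
  (a ∷ p) *ₚ q = scale a q +ₚ (0# ∷ (p *ₚ q))

  polyRawRing : RawRing c ℓ
  polyRawRing = record
    { Carrier = Poly
    ; _≈_     = _≈ₚ_
    ; _+_     = _+ₚ_
    ; _*_     = _*ₚ_
    ; -_      = map -_
    ; 0#      = []
    ; 1#      = 1# ∷ []
    }

  X : Poly
  X = 0# ∷ 1# ∷ []

  -- derivFrom k (b₀ ∷ b₁ ∷ …) = k b₀ ∷ (k+1) b₁ ∷ …
  derivFrom : ℕ → Poly → Poly
  derivFrom k []      = []
  derivFrom k (b ∷ p) = (k × b) ∷ derivFrom (suc k) p

  deriv : Poly → Poly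
  deriv []      = []
  deriv (a ∷ p) = derivFrom 1 p

module PowerSeries {c ℓ} (R : RawRing c ℓ) where
  open RawRing R
  open RawSemiringDefs rawSemiring using (sum)

  Series : Set c
  Series = ℕ → Carrier

  infix 4 _≋_
  _≋_ : Series → Series → Set ℓ
  f ≋ g = ∀ n → f n ≈ g n

  -- Long division by a series g with constant term 1: comparing coefficients
  -- of zⁿ in q · g = f gives qₙ = fₙ - Σ_{i<n} q_{n-1-i} g_{i+1}.
  -- quotients f g n lists q_{n-1}, …, q₀.
  quotients : Series → Series → (n : ℕ) → Vector.Vector Carrier n
  quotients f g zero    = Vector.[]
  quotients f g (suc n) =
    (f n + - sum (λ i → quotients f g n i * g (suc (toℕ i)))) Vector.∷ quotients f g n

  -- Meaningful only when g 0 ≈ 1#.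
  infixl 7 _÷_
  _÷_ : Series → Series → Series
  (f ÷ g) n = Vector.head (quotients f g (suc n))

module Determinant {c ℓ} (R : RawRing c ℓ) where
  open RawRing R
  open RawSemiringDefs rawSemiring using (sum; _^_)

  Matrix : ℕ → Set c
  Matrix n = Fin n → Fin n → Carrier

  -- Laplace expansion along the first row.
  det : ∀ {n} → Matrix n → Carrier
  det {zero}  M = 1#
  det {suc n} M =
    sum (λ j → (- 1#) ^ toℕ j * (M zero j * det (λ i k → M (suc i) (punchIn j k))))

open Polynomial ℚ.+-*-rawRing public
open PowerSeries polyRawRing public
open Determinant polyRawRing public
open RawRing polyRawRing public using (_≈_; _+_; _*_; -_; 0#; 1#)
open RawSemiringDefs (RawRing.rawSemiring polyRawRing) using (_×_)

C : ℕ → Poly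
C zero    = 1#
C (suc n) = (2 ℕ.* suc n ∸ 1) × (X * C n) + X * (1# + - X) * deriv (C n)

1/_! : ℕ → ℚ
1/ n ! = ℚ._/_ (+ 1) (n !) {{n !≢0}}

egf : (ℕ → Poly) → Series
egf a n = scale (1/ n !) (a n)

egfC : Series
egfC = egf C

∂ₓ : Series → Series
∂ₓ f n = deriv (f n)

∂ₓlnC : Series
∂ₓlnC = ∂ₓ egfC ÷ egfC

-- The defining equation  Σ_{n≥1} Lₙ zⁿ/n! = ∂ₓ ln C(x;z)  solved for Lₙ;
-- that it holds, with no constant term, is L-zero and L-egf below.
L : ℕ → Poly
L n = (n !) × ∂ₓlnC n

-- Entry (i , j), for j ≥ 2, of both matrices; i and j count from 1.
entry : ℕ → ℕ → Poly
entry i j with ℕ.compare i j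
... | less _ zero    = - 1#
... | less _ (suc _) = 0#
... | equal _        = (i choose (i ∸ 1)) × X
... | greater _ _    = (i choose (j ∸ 1)) × C (i ∸ j)

withFirstColumn : ∀ {n} → (Fin n → Poly) → Matrix n
withFirstColumn a i zero      = a i
withFirstColumn a i j@(suc _) = entry (suc (toℕ i)) (suc (toℕ j))

matrixL : ∀ n → Matrix n
matrixL n = withFirstColumn (λ i → L (suc (toℕ i)))

columnC′ : ∀ {n} → Fin n → Poly
columnC′ zero    = 1#
columnC′ (suc i) = deriv (C (suc (toℕ i)))

matrixC′ : ∀ n → Matrix n
matrixC′ n = withFirstColumn columnC′

L-zero : L 0 ≈ 0#
L-zero k = refl

private
  module Q = RawSemiringDefs ℚ.+-*-rawSemiring

  coeff-+ : ∀ p q k → coeff (p + q) k ≡ coeff p k ℚ.+ coeff q k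
  coeff-+ []      q       k       = sym (ℚ.+-identityˡ _)
  coeff-+ (a ∷ p) []      k       = sym (ℚ.+-identityʳ _)
  coeff-+ (a ∷ p) (b ∷ q) zero    = refl
  coeff-+ (a ∷ p) (b ∷ q) (suc k) = coeff-+ p q k

  coeff-scale : ∀ c p k → coeff (scale c p) k ≡ c ℚ.* coeff p k
  coeff-scale c []      k       = sym (ℚ.*-zeroʳ c)
  coeff-scale c (a ∷ p) zero    = refl
  coeff-scale c (a ∷ p) (suc k) = coeff-scale c p k

  coeff-× : ∀ m p k → coeff (m × p) k ≡ m Q.× coeff p k
  coeff-× zero    p k = refl
  coeff-× (suc m) p k = trans (coeff-+ p (m × p) k) (cong (coeff p k ℚ.+_) (coeff-× m p k))

  fromℕ : ℕ → ℚ
  fromℕ m = + m ℚ./ 1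

  fromℕ-suc : ∀ m → fromℕ (suc m) ≡ ℚ.1ℚ ℚ.+ fromℕ m
  fromℕ-suc m = ℚ.toℚᵘ-injective (begin
    ℚ.toℚᵘ (fromℕ (suc m))            ≈⟨ ℚ.toℚᵘ-fromℚᵘ (ℚᵘ.mkℚᵘ (+ suc m) 0) ⟩
    ℚᵘ.mkℚᵘ (+ suc m) 0               ≈⟨ ℚᵘ.*≡* (cong (ℤ._* + 1) (cong (λ t → + 1 ℤ.+ t) (sym (ℤ.*-identityʳ (+ m))))) ⟩
    ℚᵘ.1ℚᵘ ℚᵘ.+ ℚᵘ.mkℚᵘ (+ m) 0       ≈⟨ ℚᵘ.+-congʳ ℚᵘ.1ℚᵘ (ℚᵘ.≃-sym (ℚ.toℚᵘ-fromℚᵘ (ℚᵘ.mkℚᵘ (+ m) 0))) ⟩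
    ℚᵘ.1ℚᵘ ℚᵘ.+ ℚ.toℚᵘ (fromℕ m)      ≈⟨ ℚᵘ.≃-sym (ℚ.toℚᵘ-homo-+ ℚ.1ℚ (fromℕ m)) ⟩
    ℚ.toℚᵘ (ℚ.1ℚ ℚ.+ fromℕ m)         ∎)
    where open ℚᵘ.≃-Reasoning

  ×-fromℕ : ∀ m a → m Q.× a ≡ fromℕ m ℚ.* a
  ×-fromℕ zero    a = sym (ℚ.*-zeroˡ a)
  ×-fromℕ (suc m) a = begin
    a ℚ.+ m Q.× a                    ≡⟨ cong₂ ℚ._+_ (sym (ℚ.*-identityˡ a)) (×-fromℕ m a) ⟩
    ℚ.1ℚ ℚ.* a ℚ.+ fromℕ m ℚ.* a     ≡⟨ sym (ℚ.*-distribʳ-+ a ℚ.1ℚ (fromℕ m)) ⟩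
    (ℚ.1ℚ ℚ.+ fromℕ m) ℚ.* a         ≡⟨ cong (ℚ._* a) (sym (fromℕ-suc m)) ⟩
    fromℕ (suc m) ℚ.* a              ∎
    where open ≡-Reasoning

  1/m*m : ∀ m {{_ : NonZero m}} → (+ 1 ℚ./ m) ℚ.* fromℕ m ≡ ℚ.1ℚ
  1/m*m m@(suc m-1) = ℚ.toℚᵘ-injective (begin
    ℚ.toℚᵘ ((+ 1 ℚ./ m) ℚ.* fromℕ m)              ≈⟨ ℚ.toℚᵘ-homo-* (+ 1 ℚ./ m) (fromℕ m) ⟩
    ℚ.toℚᵘ (+ 1 ℚ./ m) ℚᵘ.* ℚ.toℚᵘ (fromℕ m)      ≈⟨ ℚᵘ.*-cong (ℚ.toℚᵘ-fromℚᵘ (ℚᵘ.mkℚᵘ (+ 1) m-1)) (ℚ.toℚᵘ-fromℚᵘ (ℚᵘ.mkℚᵘ (+ m) 0)) ⟩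
    ℚᵘ.mkℚᵘ (+ 1) m-1 ℚᵘ.* ℚᵘ.mkℚᵘ (+ m) 0        ≈⟨ ℚᵘ.*≡* (trans (ℤ.*-identityʳ _) (cong (+ 1 ℤ.*_) (sym (ℤ.*-identityʳ (+ m))))) ⟩
    ℚᵘ.1ℚᵘ                                        ∎)
    where open ℚᵘ.≃-Reasoning

L-egf : egf L ≋ ∂ₓlnC
L-egf n k = begin
  coeff (scale c (m × p)) k        ≡⟨ coeff-scale c (m × p) k ⟩
  c ℚ.* coeff (m × p) k            ≡⟨ cong (c ℚ.*_) (trans (coeff-× m p k) (×-fromℕ m a)) ⟩
  c ℚ.* (fromℕ m ℚ.* a)            ≡⟨ sym (ℚ.*-assoc c (fromℕ m) a) ⟩
  c ℚ.* fromℕ m ℚ.* a              ≡⟨ cong (ℚ._* a) (1/m*m m {{n !≢0}}) ⟩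
  ℚ.1ℚ ℚ.* a                       ≡⟨ ℚ.*-identityˡ a ⟩
  a                                ∎
  where
  open ≡-Reasoning
  m = n !
  c = 1/ n !
  p = ∂ₓlnC n
  a = coeff p k

{-# OPTIONS --safe #-}

-- In exponential generating functions, C satisfies (1 - 2xz) C_z = x C + x (1 - x) C_x, and
-- F := 1 - (x - 1) z - ∫ C dz satisfies (1 - 2xz) F_z = - x F + x (1 - x) F_x.  Hence P := C F
-- satisfies (1 - 2xz) P_z = x (1 - x) P_x, and P(z = 0) = 1 forces P = 1.  So F is the reciprocal
-- of C, and with Λ := C_x / C one gets F C_x = Λ and F Λ = F C_x / C = - F_x.  Comparing
-- coefficients, both are triangular linear systems whose matrix is made of the coefficients of
-- - F, and the Hessenberg determinants are Cramer's rule for them.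
module Submission where

open import Algebra.Bundles using (CommutativeRing; Semiring)
import Algebra.Definitions.RawSemiring as RawSemiringDefs
import Algebra.Properties.CommutativeMonoid.Mult as CommutativeMonoidMult
import Algebra.Properties.CommutativeSemigroup as CommutativeSemigroupProperties
import Algebra.Properties.Group as GroupProperties
import Algebra.Properties.Ring as RingProperties
import Algebra.Properties.Semiring.Mult as SemiringMult
import Algebra.Properties.Semiring.Sum as SemiringSum
import Algebra.Solver.Ring.NaturalCoefficients.Default as Solver
open import Data.Fin.Base using (Fin; zero; suc; toℕ; punchIn; inject₁; fromℕ)
open import Data.Fin.Properties using (toℕ<n; toℕ-inject₁; toℕ-fromℕ)
open import Data.List.Base using ([]; _∷_; map)
open import Data.Nat.Base as ℕ
  using (ℕ; zero; suc; _∸_; _!; _≤_; _<_; s≤s; s≤s⁻¹; z≤n; z<s; s<s; NonZero)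
open import Data.Nat.Combinatorics
  using (nCk≡n!/k![n-k]!; k![n∸k]!∣n!; k>n⇒nCk≡0; nCn≡1; nCk≡nC[n∸k]; nCk+nC[k+1]≡[n+1]C[k+1])
  renaming (_C_ to _choose_)
open import Data.Nat.DivMod using (m/n*n≡m)
open import Data.Nat.Properties as ℕ
  using (n<1+n; n≤1+n; ≤-refl; <-irrefl; <⇒≱; ≤⇒≯; m≤m+n; m<m+n; m≤n⇒m≤1+n;
         n∸n≡0; m+n∸n≡m; m+n∸m≡n; _!≢0; _!*_!≢0)
open import Data.Product.Base using (_,_)
open import Function.Base using (_∘_)
open import Level using (_⊔_)
open import Relation.Binary.PropositionalEquality.Core as ≡ using (_≡_)
import Relation.Binary.Reasoning.Setoid as SetoidReasoning
open import Relation.Nullary.Negation using (contradiction)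
open import Defs using (module Polynomial; module PowerSeries; module Determinant)

-- The closed form of F is read off from the matrices: from the second column on, the entry in row i
-- and column j is binom(i, j - 1) times a polynomial that depends only on i + 1 - j, namely -1, x,
-- C_1, C_2, ... The summand (x - 1) z is there because the diagonal carries x where ∫ C dz would
-- give C_0 = 1. The equations of C and F have opposite zeroth-order terms, x C and - x F. These
-- cancel in the product, and the equation that remains is one that constants solve. The unknowns
-- C_x and Λ both have constant term 0, so the column of index 0 drops out of the linear systems and
-- square ones remain. The right-hand side of the second system is the x-derivative of x, C_1, C_2,
-- ..., which explains the corner entry 1. The obstacle is that Λ arises by long division of series
-- with coefficients C_n / n!, while the recurrence and the determinants concern C_n itself.
-- Products are therefore binomial convolutions over a ring without division, and the factorials
-- enter only through the identity C Λ = C_x.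

module Multiples {c ℓ} (R : CommutativeRing c ℓ) where
  open CommutativeRing R hiding (zero)
  open SemiringMult semiring public
  open CommutativeMonoidMult +-commutativeMonoid public using (×-distrib-+)
  open SemiringSum semiring using (sum; sum-replicate; sum-replicate-zero)
  open SetoidReasoning setoid

  ×-zeroʳ : ∀ n → n × 0# ≈ 0#
  ×-zeroʳ n = trans (sym (sum-replicate n)) (sum-replicate-zero n)

  ×-distrib-sum : ∀ {n} k (t : Fin n → Carrier) → k × sum t ≈ sum (λ i → k × t i)
  ×-distrib-sum {zero}  k t = ×-zeroʳ k
  ×-distrib-sum {suc n} k t =
    trans (×-distrib-+ _ _ k) (+-congˡ (×-distrib-sum k (t ∘ suc)))

  ×-interchange : ∀ m n a b → (m ℕ.* n) × (a * b) ≈ (m × a) * (n × b)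
  ×-interchange m n a b = begin
    (m ℕ.* n) × (a * b)    ≈⟨ ×-assocˡ _ m n ⟨
    m × (n × (a * b))      ≈⟨ ×-congʳ m (×-comm-* n a b) ⟨
    m × (a * (n × b))      ≈⟨ ×-assoc-* m a _ ⟨
    (m × a) * (n × b)      ∎

-- The ring of polynomials as coefficient lists, and its derivation

module PolynomialRing {c ℓ} (R : CommutativeRing c ℓ) where
  open CommutativeRing R hiding (zero)
  open Polynomial rawRing
  open Multiples R using (_×_; ×-congʳ; ×-comm-*; ×-zeroʳ; ×-distrib-+)
  open CommutativeSemigroupProperties +-commutativeSemigroup using (interchange; x∙yz≈y∙xz)
  open RingProperties ring using (-0#≈0#)
  open SetoidReasoning setoid

  coeff-+ : ∀ p q k → coeff (p +ₚ q) k ≈ coeff p k + coeff q k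
  coeff-+ []      q       k       = sym (+-identityˡ _)
  coeff-+ (a ∷ p) []      k       = sym (+-identityʳ _)
  coeff-+ (a ∷ p) (b ∷ q) zero    = refl
  coeff-+ (a ∷ p) (b ∷ q) (suc k) = coeff-+ p q k

  coeff-scale : ∀ a p k → coeff (scale a p) k ≈ a * coeff p k
  coeff-scale a []      k       = sym (zeroʳ a)
  coeff-scale a (b ∷ p) zero    = refl
  coeff-scale a (b ∷ p) (suc k) = coeff-scale a p k

  coeff-neg : ∀ p k → coeff (map (-_) p) k ≈ - coeff p k
  coeff-neg []      k       = sym -0#≈0#
  coeff-neg (a ∷ p) zero    = refl
  coeff-neg (a ∷ p) (suc k) = coeff-neg p k

  coeff-∷*-zero : ∀ a p q → coeff ((a ∷ p) *ₚ q) 0 ≈ a * coeff q 0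
  coeff-∷*-zero a p q = begin
    coeff (scale a q +ₚ (0# ∷ p *ₚ q)) 0  ≈⟨ coeff-+ (scale a q) _ 0 ⟩
    coeff (scale a q) 0 + 0#              ≈⟨ +-identityʳ _ ⟩
    coeff (scale a q) 0                   ≈⟨ coeff-scale a q 0 ⟩
    a * coeff q 0                         ∎

  coeff-∷*-suc : ∀ a p q k →
    coeff ((a ∷ p) *ₚ q) (suc k) ≈ a * coeff q (suc k) + coeff (p *ₚ q) k
  coeff-∷*-suc a p q k =
    trans (coeff-+ (scale a q) _ (suc k)) (+-congʳ (coeff-scale a q (suc k)))

  *ₚ-zeroʳ : ∀ p → p *ₚ [] ≈ₚ []
  *ₚ-zeroʳ []      k       = refl
  *ₚ-zeroʳ (a ∷ p) zero    = refl
  *ₚ-zeroʳ (a ∷ p) (suc k) = *ₚ-zeroʳ p k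

  coeff-*∷-zero : ∀ p b q → coeff (p *ₚ (b ∷ q)) 0 ≈ coeff p 0 * b
  coeff-*∷-zero []      b q = sym (zeroˡ b)
  coeff-*∷-zero (a ∷ p) b q = coeff-∷*-zero a p (b ∷ q)

  -- Multiplication recurses on its left factor only. This is the mirror recursion on the right
  -- factor, and commutativity follows by playing the two against each other.
  coeff-*∷-suc : ∀ p b q k →
    coeff (p *ₚ (b ∷ q)) (suc k) ≈ coeff p (suc k) * b + coeff (p *ₚ q) k
  coeff-*∷-suc []      b q k       = sym (trans (+-identityʳ _) (zeroˡ b))
  coeff-*∷-suc (a ∷ p) b q zero    = begin
    coeff ((a ∷ p) *ₚ (b ∷ q)) 1              ≈⟨ coeff-∷*-suc a p (b ∷ q) 0 ⟩
    a * coeff q 0 + coeff (p *ₚ (b ∷ q)) 0    ≈⟨ +-comm _ _ ⟩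
    coeff (p *ₚ (b ∷ q)) 0 + a * coeff q 0    ≈⟨ +-cong (coeff-*∷-zero p b q) (sym (coeff-∷*-zero a p q)) ⟩
    coeff p 0 * b + coeff ((a ∷ p) *ₚ q) 0    ∎
  coeff-*∷-suc (a ∷ p) b q (suc k) = begin
    coeff ((a ∷ p) *ₚ (b ∷ q)) (suc (suc k))
      ≈⟨ coeff-∷*-suc a p (b ∷ q) (suc k) ⟩
    a * coeff q (suc k) + coeff (p *ₚ (b ∷ q)) (suc k)
      ≈⟨ +-congˡ (coeff-*∷-suc p b q k) ⟩
    a * coeff q (suc k) + (coeff p (suc k) * b + coeff (p *ₚ q) k)
      ≈⟨ x∙yz≈y∙xz _ _ _ ⟩
    coeff p (suc k) * b + (a * coeff q (suc k) + coeff (p *ₚ q) k)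
      ≈⟨ +-congˡ (coeff-∷*-suc a p q k) ⟨
    coeff p (suc k) * b + coeff ((a ∷ p) *ₚ q) (suc k)  ∎

  *ₚ-comm : ∀ p q → p *ₚ q ≈ₚ q *ₚ p
  *ₚ-comm []      q k       = sym (*ₚ-zeroʳ q k)
  *ₚ-comm (a ∷ p) q zero    = begin
    coeff ((a ∷ p) *ₚ q) 0  ≈⟨ coeff-∷*-zero a p q ⟩
    a * coeff q 0           ≈⟨ *-comm _ _ ⟩
    coeff q 0 * a           ≈⟨ coeff-*∷-zero q a p ⟨
    coeff (q *ₚ (a ∷ p)) 0  ∎
  *ₚ-comm (a ∷ p) q (suc k) = begin
    coeff ((a ∷ p) *ₚ q) (suc k)                ≈⟨ coeff-∷*-suc a p q k ⟩
    a * coeff q (suc k) + coeff (p *ₚ q) k      ≈⟨ +-cong (*-comm _ _) (*ₚ-comm p q k) ⟩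
    coeff q (suc k) * a + coeff (q *ₚ p) k      ≈⟨ coeff-*∷-suc q a p k ⟨
    coeff (q *ₚ (a ∷ p)) (suc k)                ∎

  *ₚ-congˡ : ∀ p {q r} → q ≈ₚ r → p *ₚ q ≈ₚ p *ₚ r
  *ₚ-congˡ []      q≈r k = refl
  *ₚ-congˡ (a ∷ p) {q} {r} q≈r zero = begin
    coeff ((a ∷ p) *ₚ q) 0  ≈⟨ coeff-∷*-zero a p q ⟩
    a * coeff q 0           ≈⟨ *-congˡ (q≈r 0) ⟩
    a * coeff r 0           ≈⟨ coeff-∷*-zero a p r ⟨
    coeff ((a ∷ p) *ₚ r) 0  ∎
  *ₚ-congˡ (a ∷ p) {q} {r} q≈r (suc k) = begin
    coeff ((a ∷ p) *ₚ q) (suc k)            ≈⟨ coeff-∷*-suc a p q k ⟩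
    a * coeff q (suc k) + coeff (p *ₚ q) k  ≈⟨ +-cong (*-congˡ (q≈r (suc k))) (*ₚ-congˡ p q≈r k) ⟩
    a * coeff r (suc k) + coeff (p *ₚ r) k  ≈⟨ coeff-∷*-suc a p r k ⟨
    coeff ((a ∷ p) *ₚ r) (suc k)            ∎

  *ₚ-congʳ : ∀ r {p q} → p ≈ₚ q → p *ₚ r ≈ₚ q *ₚ r
  *ₚ-congʳ r {p} {q} p≈q k =
    trans (*ₚ-comm p r k) (trans (*ₚ-congˡ r p≈q k) (*ₚ-comm r q k))

  *ₚ-distribˡ : ∀ p q r → p *ₚ (q +ₚ r) ≈ₚ p *ₚ q +ₚ p *ₚ r
  *ₚ-distribˡ []      q r k = refl
  *ₚ-distribˡ (a ∷ p) q r zero = begin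
    coeff ((a ∷ p) *ₚ (q +ₚ r)) 0                    ≈⟨ coeff-∷*-zero a p (q +ₚ r) ⟩
    a * coeff (q +ₚ r) 0                             ≈⟨ *-congˡ (coeff-+ q r 0) ⟩
    a * (coeff q 0 + coeff r 0)                      ≈⟨ distribˡ _ _ _ ⟩
    a * coeff q 0 + a * coeff r 0                    ≈⟨ +-cong (coeff-∷*-zero a p q) (coeff-∷*-zero a p r) ⟨
    coeff ((a ∷ p) *ₚ q) 0 + coeff ((a ∷ p) *ₚ r) 0  ≈⟨ coeff-+ ((a ∷ p) *ₚ q) ((a ∷ p) *ₚ r) 0 ⟨
    coeff ((a ∷ p) *ₚ q +ₚ (a ∷ p) *ₚ r) 0           ∎
  *ₚ-distribˡ (a ∷ p) q r (suc k) = begin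
    coeff ((a ∷ p) *ₚ (q +ₚ r)) (suc k)
      ≈⟨ coeff-∷*-suc a p (q +ₚ r) k ⟩
    a * coeff (q +ₚ r) (suc k) + coeff (p *ₚ (q +ₚ r)) k
      ≈⟨ +-cong (*-congˡ (coeff-+ q r (suc k))) (*ₚ-distribˡ p q r k) ⟩
    a * (coeff q (suc k) + coeff r (suc k)) + coeff (p *ₚ q +ₚ p *ₚ r) k
      ≈⟨ +-cong (distribˡ _ _ _) (coeff-+ (p *ₚ q) (p *ₚ r) k) ⟩
    (a * coeff q (suc k) + a * coeff r (suc k)) + (coeff (p *ₚ q) k + coeff (p *ₚ r) k)
      ≈⟨ interchange _ _ _ _ ⟩
    (a * coeff q (suc k) + coeff (p *ₚ q) k) + (a * coeff r (suc k) + coeff (p *ₚ r) k)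
      ≈⟨ +-cong (coeff-∷*-suc a p q k) (coeff-∷*-suc a p r k) ⟨
    coeff ((a ∷ p) *ₚ q) (suc k) + coeff ((a ∷ p) *ₚ r) (suc k)
      ≈⟨ coeff-+ ((a ∷ p) *ₚ q) ((a ∷ p) *ₚ r) (suc k) ⟨
    coeff ((a ∷ p) *ₚ q +ₚ (a ∷ p) *ₚ r) (suc k)  ∎

  +ₚ-cong : ∀ p q r s → p ≈ₚ q → r ≈ₚ s → p +ₚ r ≈ₚ q +ₚ s
  +ₚ-cong p q r s p≈q r≈s k =
    trans (coeff-+ p r k) (trans (+-cong (p≈q k) (r≈s k)) (sym (coeff-+ q s k)))

  *ₚ-distribʳ : ∀ r p q → (p +ₚ q) *ₚ r ≈ₚ p *ₚ r +ₚ q *ₚ r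
  *ₚ-distribʳ r p q k = begin
    coeff ((p +ₚ q) *ₚ r) k      ≈⟨ *ₚ-comm (p +ₚ q) r k ⟩
    coeff (r *ₚ (p +ₚ q)) k      ≈⟨ *ₚ-distribˡ r p q k ⟩
    coeff (r *ₚ p +ₚ r *ₚ q) k   ≈⟨ +ₚ-cong (r *ₚ p) (p *ₚ r) (r *ₚ q) (q *ₚ r) (*ₚ-comm r p) (*ₚ-comm r q) k ⟩
    coeff (p *ₚ r +ₚ q *ₚ r) k   ∎

  coeff-scale-* : ∀ a p q k → coeff (scale a p *ₚ q) k ≈ a * coeff (p *ₚ q) k
  coeff-scale-* a []      q k = sym (zeroʳ a)
  coeff-scale-* a (b ∷ p) q zero = begin
    coeff ((a * b ∷ scale a p) *ₚ q) 0  ≈⟨ coeff-∷*-zero (a * b) (scale a p) q ⟩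
    a * b * coeff q 0                   ≈⟨ *-assoc _ _ _ ⟩
    a * (b * coeff q 0)                 ≈⟨ *-congˡ (coeff-∷*-zero b p q) ⟨
    a * coeff ((b ∷ p) *ₚ q) 0          ∎
  coeff-scale-* a (b ∷ p) q (suc k) = begin
    coeff ((a * b ∷ scale a p) *ₚ q) (suc k)            ≈⟨ coeff-∷*-suc (a * b) (scale a p) q k ⟩
    a * b * coeff q (suc k) + coeff (scale a p *ₚ q) k  ≈⟨ +-cong (*-assoc _ _ _) (coeff-scale-* a p q k) ⟩
    a * (b * coeff q (suc k)) + a * coeff (p *ₚ q) k    ≈⟨ distribˡ _ _ _ ⟨
    a * (b * coeff q (suc k) + coeff (p *ₚ q) k)        ≈⟨ *-congˡ (coeff-∷*-suc b p q k) ⟨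
    a * coeff ((b ∷ p) *ₚ q) (suc k)                    ∎

  coeff-0∷*-suc : ∀ p q k → coeff ((0# ∷ p) *ₚ q) (suc k) ≈ coeff (p *ₚ q) k
  coeff-0∷*-suc p q k =
    trans (coeff-∷*-suc 0# p q k) (trans (+-congʳ (zeroˡ _)) (+-identityˡ _))

  *ₚ-assoc : ∀ p q r → (p *ₚ q) *ₚ r ≈ₚ p *ₚ (q *ₚ r)
  *ₚ-assoc []      q r k = refl
  *ₚ-assoc (a ∷ p) q r k = begin
    coeff ((scale a q +ₚ (0# ∷ p *ₚ q)) *ₚ r) k
      ≈⟨ *ₚ-distribʳ r (scale a q) (0# ∷ p *ₚ q) k ⟩
    coeff (scale a q *ₚ r +ₚ (0# ∷ p *ₚ q) *ₚ r) k
      ≈⟨ +ₚ-cong (scale a q *ₚ r) (scale a (q *ₚ r))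
                 ((0# ∷ p *ₚ q) *ₚ r) (0# ∷ p *ₚ (q *ₚ r)) scale-* shift k ⟩
    coeff (scale a (q *ₚ r) +ₚ (0# ∷ p *ₚ (q *ₚ r))) k  ∎
    where
    scale-* : scale a q *ₚ r ≈ₚ scale a (q *ₚ r)
    scale-* i = trans (coeff-scale-* a q r i) (sym (coeff-scale a (q *ₚ r) i))
    shift : (0# ∷ p *ₚ q) *ₚ r ≈ₚ 0# ∷ p *ₚ (q *ₚ r)
    shift zero    = trans (coeff-∷*-zero 0# (p *ₚ q) r) (zeroˡ _)
    shift (suc i) = trans (coeff-0∷*-suc (p *ₚ q) r i) (*ₚ-assoc p q r i)

  *ₚ-identityˡ : ∀ p → (1# ∷ []) *ₚ p ≈ₚ p
  *ₚ-identityˡ p zero    = trans (coeff-∷*-zero 1# [] p) (*-identityˡ _)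
  *ₚ-identityˡ p (suc k) =
    trans (coeff-∷*-suc 1# [] p k) (trans (+-identityʳ _) (*-identityˡ _))

  -- The operations are literally those of `polyRawRing`, so whatever is proved for determinants and
  -- quotients over this ring applies unchanged to the ones in the theorem.
  polyRing : CommutativeRing c ℓ
  polyRing = record
    { Carrier = Poly
    ; _≈_ = _≈ₚ_
    ; _+_ = _+ₚ_
    ; _*_ = _*ₚ_
    ; -_  = map (-_)
    ; 0#  = []
    ; 1#  = 1# ∷ []
    ; isCommutativeRing = record
      { isRing = record
        { +-isAbelianGroup = record
          { isGroup = record
            { isMonoid = record
              { isSemigroup = record
                { isMagma = record
                  { isEquivalence = record
                    { refl  = λ k → refl
                    ; sym   = λ p≈q k → sym (p≈q k)
                    ; trans = λ p≈q q≈r k → trans (p≈q k) (q≈r k)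
                    }
                  ; ∙-cong = λ {p} {q} {r} {s} → +ₚ-cong p q r s
                  }
                ; assoc = λ p q r k → begin
                    coeff ((p +ₚ q) +ₚ r) k              ≈⟨ coeff-+ (p +ₚ q) r k ⟩
                    coeff (p +ₚ q) k + coeff r k         ≈⟨ +-congʳ (coeff-+ p q k) ⟩
                    coeff p k + coeff q k + coeff r k    ≈⟨ +-assoc _ _ _ ⟩
                    coeff p k + (coeff q k + coeff r k)  ≈⟨ +-congˡ (coeff-+ q r k) ⟨
                    coeff p k + coeff (q +ₚ r) k         ≈⟨ coeff-+ p (q +ₚ r) k ⟨
                    coeff (p +ₚ (q +ₚ r)) k              ∎
                }
              ; identity = (λ p k → refl)
                         , (λ p k → trans (coeff-+ p [] k) (+-identityʳ _))
              }
            ; inverse = (λ p k → trans (coeff-+ (map (-_) p) p k)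
                          (trans (+-congʳ (coeff-neg p k)) (-‿inverseˡ _)))
                      , (λ p k → trans (coeff-+ p (map (-_) p) k)
                          (trans (+-congˡ (coeff-neg p k)) (-‿inverseʳ _)))
            ; ⁻¹-cong = λ {p} {q} p≈q k →
                trans (coeff-neg p k) (trans (-‿cong (p≈q k)) (sym (coeff-neg q k)))
            }
          ; comm = λ p q k →
              trans (coeff-+ p q k) (trans (+-comm _ _) (sym (coeff-+ q p k)))
          }
        ; *-cong     = λ {p} {q} {r} {s} p≈q r≈s k →
            trans (*ₚ-congˡ p {r} {s} r≈s k) (*ₚ-congʳ s {p} {q} p≈q k)
        ; *-assoc    = *ₚ-assoc
        ; *-identity = *ₚ-identityˡ
                     , (λ p k → trans (*ₚ-comm p (1# ∷ []) k) (*ₚ-identityˡ p k))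
        ; distrib    = *ₚ-distribˡ , *ₚ-distribʳ
        }
      ; *-comm = *ₚ-comm
      }
    }

  coeff-derivFrom : ∀ m p k → coeff (derivFrom m p) k ≈ (m ℕ.+ k) × coeff p k
  coeff-derivFrom m []      k       = sym (×-zeroʳ (m ℕ.+ k))
  coeff-derivFrom m (a ∷ p) zero    rewrite ℕ.+-identityʳ m = refl
  coeff-derivFrom m (a ∷ p) (suc k) rewrite ℕ.+-suc m k = coeff-derivFrom (suc m) p k

  coeff-deriv : ∀ p k → coeff (deriv p) k ≈ suc k × coeff p (suc k)
  coeff-deriv []      k = sym (×-zeroʳ (suc k))
  coeff-deriv (a ∷ p) k = coeff-derivFrom 1 p k

  deriv-cong : ∀ p q → p ≈ₚ q → deriv p ≈ₚ deriv q
  deriv-cong p q p≈q k = begin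
    coeff (deriv p) k          ≈⟨ coeff-deriv p k ⟩
    suc k × coeff p (suc k)    ≈⟨ ×-congʳ (suc k) (p≈q (suc k)) ⟩
    suc k × coeff q (suc k)    ≈⟨ coeff-deriv q k ⟨
    coeff (deriv q) k          ∎

  deriv-+ : ∀ p q → deriv (p +ₚ q) ≈ₚ deriv p +ₚ deriv q
  deriv-+ p q k = begin
    coeff (deriv (p +ₚ q)) k                             ≈⟨ coeff-deriv (p +ₚ q) k ⟩
    suc k × coeff (p +ₚ q) (suc k)                       ≈⟨ ×-congʳ (suc k) (coeff-+ p q (suc k)) ⟩
    suc k × (coeff p (suc k) + coeff q (suc k))          ≈⟨ ×-distrib-+ _ _ (suc k) ⟩
    suc k × coeff p (suc k) + suc k × coeff q (suc k)    ≈⟨ +-cong (coeff-deriv p k) (coeff-deriv q k) ⟨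
    coeff (deriv p) k + coeff (deriv q) k                ≈⟨ coeff-+ (deriv p) (deriv q) k ⟨
    coeff (deriv p +ₚ deriv q) k                         ∎

  deriv-∷ : ∀ a p → deriv (a ∷ p) ≈ₚ p +ₚ (0# ∷ deriv p)
  deriv-∷ a p k = trans (coeff-deriv (a ∷ p) k)
    (sym (trans (coeff-+ p (0# ∷ deriv p) k) (+-congˡ (tail k))))
    where
    tail : ∀ k → coeff (0# ∷ deriv p) k ≈ k × coeff p k
    tail zero    = refl
    tail (suc k) = coeff-deriv p k

  -- Induction on p, read as a + x p. In `suc k × coeff (p *ₚ q) k` one copy is the summand p of (a
  -- + x p)' = p + x p', and the other k copies are a coefficient of x (p q)'. The induction
  -- hypothesis is thus needed one degree lower, which is why `tail` separates k = 0.
  deriv-* : ∀ p q → deriv (p *ₚ q) ≈ₚ deriv p *ₚ q +ₚ p *ₚ deriv q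
  deriv-* []      q k = refl
  deriv-* (a ∷ p) q k = begin
    coeff (deriv ((a ∷ p) *ₚ q)) k
      ≈⟨ coeff-deriv ((a ∷ p) *ₚ q) k ⟩
    suc k × coeff ((a ∷ p) *ₚ q) (suc k)
      ≈⟨ ×-congʳ (suc k) (coeff-∷*-suc a p q k) ⟩
    suc k × (a * coeff q (suc k) + coeff (p *ₚ q) k)
      ≈⟨ ×-distrib-+ _ _ (suc k) ⟩
    suc k × (a * coeff q (suc k)) + suc k × coeff (p *ₚ q) k
      ≈⟨ +-congʳ (×-comm-* (suc k) a _) ⟨
    a * (suc k × coeff q (suc k)) + (coeff (p *ₚ q) k + k × coeff (p *ₚ q) k)
      ≈⟨ x∙yz≈y∙xz _ _ _ ⟩
    coeff (p *ₚ q) k + (a * (suc k × coeff q (suc k)) + k × coeff (p *ₚ q) k)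
      ≈⟨ +-congˡ (+-congʳ (*-congˡ (coeff-deriv q k))) ⟨
    coeff (p *ₚ q) k + (a * coeff (deriv q) k + k × coeff (p *ₚ q) k)
      ≈⟨ +-congˡ (tail k) ⟩
    coeff (p *ₚ q) k + (coeff ((0# ∷ deriv p) *ₚ q) k + coeff ((a ∷ p) *ₚ deriv q) k)
      ≈⟨ +-assoc _ _ _ ⟨
    coeff (p *ₚ q) k + coeff ((0# ∷ deriv p) *ₚ q) k + coeff ((a ∷ p) *ₚ deriv q) k
      ≈⟨ +-congʳ (coeff-+ (p *ₚ q) ((0# ∷ deriv p) *ₚ q) k) ⟨
    coeff (p *ₚ q +ₚ (0# ∷ deriv p) *ₚ q) k + coeff ((a ∷ p) *ₚ deriv q) k
      ≈⟨ +-congʳ (*ₚ-distribʳ q p (0# ∷ deriv p) k) ⟨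
    coeff ((p +ₚ (0# ∷ deriv p)) *ₚ q) k + coeff ((a ∷ p) *ₚ deriv q) k
      ≈⟨ +-congʳ (*ₚ-congʳ q {deriv (a ∷ p)} {p +ₚ (0# ∷ deriv p)} (deriv-∷ a p) k) ⟨
    coeff (deriv (a ∷ p) *ₚ q) k + coeff ((a ∷ p) *ₚ deriv q) k
      ≈⟨ coeff-+ (deriv (a ∷ p) *ₚ q) ((a ∷ p) *ₚ deriv q) k ⟨
    coeff (deriv (a ∷ p) *ₚ q +ₚ (a ∷ p) *ₚ deriv q) k  ∎
    where
    tail : ∀ k → a * coeff (deriv q) k + k × coeff (p *ₚ q) k ≈
                 coeff ((0# ∷ deriv p) *ₚ q) k + coeff ((a ∷ p) *ₚ deriv q) k
    tail zero    = begin
      a * coeff (deriv q) 0 + 0#  ≈⟨ +-comm _ _ ⟩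
      0# + a * coeff (deriv q) 0
        ≈⟨ +-cong (trans (coeff-∷*-zero 0# (deriv p) q) (zeroˡ _)) (coeff-∷*-zero a p (deriv q)) ⟨
      coeff ((0# ∷ deriv p) *ₚ q) 0 + coeff ((a ∷ p) *ₚ deriv q) 0  ∎
    tail (suc k) = begin
      a * coeff (deriv q) (suc k) + suc k × coeff (p *ₚ q) (suc k)
        ≈⟨ +-congˡ (coeff-deriv (p *ₚ q) k) ⟨
      a * coeff (deriv q) (suc k) + coeff (deriv (p *ₚ q)) k
        ≈⟨ +-congˡ (trans (deriv-* p q k) (coeff-+ (deriv p *ₚ q) (p *ₚ deriv q) k)) ⟩
      a * coeff (deriv q) (suc k) + (coeff (deriv p *ₚ q) k + coeff (p *ₚ deriv q) k)
        ≈⟨ x∙yz≈y∙xz _ _ _ ⟩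
      coeff (deriv p *ₚ q) k + (a * coeff (deriv q) (suc k) + coeff (p *ₚ deriv q) k)
        ≈⟨ +-cong (coeff-0∷*-suc (deriv p) q k) (coeff-∷*-suc a p (deriv q) k) ⟨
      coeff ((0# ∷ deriv p) *ₚ q) (suc k) + coeff ((a ∷ p) *ₚ deriv q) (suc k)  ∎

-- Hessenberg determinants and triangular systems

module HessenbergDeterminant {c ℓ} (R : CommutativeRing c ℓ) where
  open CommutativeRing R hiding (zero)
  open Determinant rawRing
  open RawSemiringDefs (Semiring.rawSemiring semiring) using (_^_)
  open SemiringSum semiring using (sum; sum-cong-≋; sum-replicate-zero)
  open RingProperties ring using (-1*x≈-x)
  open GroupProperties +-group using (⁻¹-involutive; ⁻¹-injective; inverseˡ-unique)
  open Solver commutativeSemiring using (solve; con; _:+_; _:*_; _:=_)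
  open SetoidReasoning setoid

  det-cong : ∀ {n} {M N : Matrix n} → (∀ i j → M i j ≈ N i j) → det M ≈ det N
  det-cong {zero}  M≈N = refl
  det-cong {suc n} M≈N = sum-cong-≋ {suc n} λ j →
    *-congˡ {(- 1#) ^ toℕ j} (*-cong (M≈N zero j) (det-cong λ i k → M≈N (suc i) (punchIn j k)))

  matrix : (ℕ → Carrier) → (ℕ → ℕ → Carrier) → ∀ n → Matrix n
  matrix a h n i zero    = a (toℕ i)
  matrix a h n i (suc j) = h (toℕ i) (toℕ j)

  -- As `matrix` keeps the first column apart, column j of `h` is column j + 1 of the matrix. The
  -- diagonal of `h` is therefore the superdiagonal of the matrix, and `h` itself is lower
  -- triangular with invertible diagonal.
  record IsHessenberg (h : ℕ → ℕ → Carrier) : Set ℓ where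
    field
      diagonal : ∀ i → h i i ≈ - 1#
      above    : ∀ {i j} → i < j → h i j ≈ 0#

  shift : (ℕ → ℕ → Carrier) → (ℕ → ℕ → Carrier)
  shift h i j = h (suc i) (suc j)

  shift-isHessenberg : ∀ {h} → IsHessenberg h → IsHessenberg (shift h)
  shift-isHessenberg H = record
    { diagonal = λ i → diagonal (suc i)
    ; above    = λ i<j → above (s<s i<j)
    }
    where open IsHessenberg H

  -- The first row has only two entries that count, `a 0` and the superdiagonal -1, whose sign
  -- cancels that of its cofactor. Removing column 0 promotes column 0 of `h` to first column;
  -- removing column 1 keeps `a`. Both minors have the same remainder `shift h`.
  det-expand : ∀ {h} → IsHessenberg h → ∀ a n →
    det (matrix a h (suc (suc n))) ≈
    a 0 * det (matrix (λ i → h (suc i) 0) (shift h) (suc n))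
      + det (matrix (a ∘ suc) (shift h) (suc n))
  det-expand {h} H a n = begin
    1# * (a 0 * det (minor zero)) + (- 1# * 1# * (h 0 0 * det (minor (suc zero))) + rest)
      ≈⟨ +-cong (trans (*-identityˡ _) (*-congˡ (det-cong minor₀)))
                (trans (+-cong second rest≈0) (+-identityʳ _)) ⟩
    a 0 * det (matrix (λ i → h (suc i) 0) (shift h) (suc n))
      + det (matrix (a ∘ suc) (shift h) (suc n))  ∎
    where
    open IsHessenberg H
    minor : Fin (suc (suc n)) → Matrix (suc n)
    minor j i k = matrix a h (suc (suc n)) (suc i) (punchIn j k)
    term : Fin n → Carrier
    term j = (- 1# * (- 1# * ((- 1#) ^ toℕ j))) *
      (h 0 (suc (toℕ j)) * det (minor (suc (suc j))))
    rest : Carrier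
    rest = sum term
    minor₀ : ∀ i k → minor zero i k ≈ matrix (λ i → h (suc i) 0) (shift h) (suc n) i k
    minor₀ i zero    = refl
    minor₀ i (suc k) = refl
    minor₁ : ∀ i k → minor (suc zero) i k ≈ matrix (a ∘ suc) (shift h) (suc n) i k
    minor₁ i zero    = refl
    minor₁ i (suc k) = refl
    [-1]²≈1 : - 1# * - 1# ≈ 1#
    [-1]²≈1 = trans (-1*x≈-x (- 1#)) (⁻¹-involutive 1#)
    second : - 1# * 1# * (h 0 0 * det (minor (suc zero)))
             ≈ det (matrix (a ∘ suc) (shift h) (suc n))
    second = begin
      - 1# * 1# * (h 0 0 * det (minor (suc zero)))
        ≈⟨ *-cong (*-identityʳ _) (*-cong (diagonal 0) (det-cong minor₁)) ⟩
      - 1# * (- 1# * det (matrix (a ∘ suc) (shift h) (suc n)))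
        ≈⟨ *-assoc _ _ _ ⟨
      - 1# * - 1# * det (matrix (a ∘ suc) (shift h) (suc n))
        ≈⟨ *-congʳ [-1]²≈1 ⟩
      1# * det (matrix (a ∘ suc) (shift h) (suc n))
        ≈⟨ *-identityˡ _ ⟩
      det (matrix (a ∘ suc) (shift h) (suc n))  ∎
    rest≈0 : rest ≈ 0#
    rest≈0 = trans (sum-cong-≋ {n} {term} {λ _ → 0#} λ j →
      trans (*-congˡ (trans (*-congʳ (above z<s)) (zeroˡ _))) (zeroʳ _)) (sum-replicate-zero n)

  -- Linearity in a column is not visible in an expansion along rows. Here it follows by induction:
  -- in `det-expand` the entry `a 0` multiplies a minor that is independent of the first column, and
  -- the other minor has the shifted first column.
  det-linear : ∀ {h} → IsHessenberg h → ∀ a b c n →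
    det (matrix (λ i → a i + c * b i) h (suc n)) ≈
    det (matrix a h (suc n)) + c * det (matrix b h (suc n))
  det-linear H a b c zero    = solve 3 (λ a b c →
      con 1 :* ((a :+ c :* b) :* con 1) :+ con 0
        := (con 1 :* (a :* con 1) :+ con 0) :+ c :* (con 1 :* (b :* con 1) :+ con 0))
    refl (a 0) (b 0) c
  det-linear {h} H a b c (suc n) = begin
    det (matrix (λ i → a i + c * b i) h (suc (suc n)))
      ≈⟨ det-expand H _ n ⟩
    (a 0 + c * b 0) * d + det (matrix (λ i → a (suc i) + c * b (suc i)) (shift h) (suc n))
      ≈⟨ +-congˡ (det-linear (shift-isHessenberg H) (a ∘ suc) (b ∘ suc) c n) ⟩
    (a 0 + c * b 0) * d + (dᵃ + c * dᵇ)
      ≈⟨ solve 6 (λ a b c d dᵃ dᵇ →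
           (a :+ c :* b) :* d :+ (dᵃ :+ c :* dᵇ) := (a :* d :+ dᵃ) :+ c :* (b :* d :+ dᵇ))
         refl (a 0) (b 0) c d dᵃ dᵇ ⟩
    (a 0 * d + dᵃ) + c * (b 0 * d + dᵇ)
      ≈⟨ +-cong (det-expand H a n) (*-congˡ (det-expand H b n)) ⟨
    det (matrix a h (suc (suc n))) + c * det (matrix b h (suc (suc n)))  ∎
    where
    d  = det (matrix (λ i → h (suc i) 0) (shift h) (suc n))
    dᵃ = det (matrix (a ∘ suc) (shift h) (suc n))
    dᵇ = det (matrix (b ∘ suc) (shift h) (suc n))

  -- Cramer's rule for a triangular system: eliminating u 0 from the system leaves
  -- the system with matrix shift h, and det-expand performs the same elimination.
  det≈solution : ∀ {h} → IsHessenberg h → ∀ a u →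
    (∀ m → sum {suc m} (λ j → h m (toℕ j) * u (toℕ j)) ≈ - a m) →
    ∀ n → det (matrix a h (suc n)) ≈ u n
  det≈solution {h} H a u system = solve-at
    where
    open IsHessenberg H
    a₀≈u₀ : a 0 ≈ u 0
    a₀≈u₀ = ⁻¹-injective (begin
      - a 0               ≈⟨ system 0 ⟨
      h 0 0 * u 0 + 0#    ≈⟨ +-identityʳ _ ⟩
      h 0 0 * u 0         ≈⟨ *-congʳ (diagonal 0) ⟩
      - 1# * u 0          ≈⟨ -1*x≈-x _ ⟩
      - u 0               ∎)
    reduced : ∀ m → sum {suc m} (λ j → shift h m (toℕ j) * u (suc (toℕ j)))
                    ≈ - (a (suc m) + a 0 * h (suc m) 0)
    reduced m = inverseˡ-unique _ _ (begin
      s + (a (suc m) + a 0 * h (suc m) 0)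
        ≈⟨ +-congˡ (+-congˡ (*-congʳ a₀≈u₀)) ⟩
      s + (a (suc m) + u 0 * h (suc m) 0)
        ≈⟨ solve 4 (λ s a u h → s :+ (a :+ u :* h) := (h :* u :+ s) :+ a)
           refl s (a (suc m)) (u 0) (h (suc m) 0) ⟩
      h (suc m) 0 * u 0 + s + a (suc m)
        ≈⟨ +-congʳ (system (suc m)) ⟩
      - a (suc m) + a (suc m)
        ≈⟨ -‿inverseˡ _ ⟩
      0#  ∎)
      where s = sum {suc m} (λ j → shift h m (toℕ j) * u (suc (toℕ j)))
    solve-at : ∀ n → det (matrix a h (suc n)) ≈ u n
    solve-at zero    = trans (+-identityʳ _) (trans (*-identityˡ _) (trans (*-identityʳ _) a₀≈u₀))
    solve-at (suc n) = begin
      det (matrix a h (suc (suc n)))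
        ≈⟨ det-expand H a n ⟩
      a 0 * det (matrix (λ i → h (suc i) 0) (shift h) (suc n))
        + det (matrix (a ∘ suc) (shift h) (suc n))
        ≈⟨ +-comm _ _ ⟩
      det (matrix (a ∘ suc) (shift h) (suc n))
        + a 0 * det (matrix (λ i → h (suc i) 0) (shift h) (suc n))
        ≈⟨ det-linear (shift-isHessenberg H) (a ∘ suc) (λ i → h (suc i) 0) (a 0) n ⟨
      det (matrix (λ i → a (suc i) + a 0 * h (suc i) 0) (shift h) (suc n))
        ≈⟨ det≈solution (shift-isHessenberg H) _ (u ∘ suc) reduced n ⟩
      u (suc n)  ∎

-- Binomial coefficients and products of exponential generating functions

nC0≡1 : ∀ n → n choose 0 ≡ 1
nC0≡1 n = ≡.trans (nCk≡nC[n∸k] {0} {n} z≤n) (nCn≡1 n)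

nCk*k![n∸k]!≡n! : ∀ {n k} → k ≤ n → (n choose k) ℕ.* (k ! ℕ.* (n ∸ k) !) ≡ n !
nCk*k![n∸k]!≡n! {n} {k} k≤n =
  ≡.trans (≡.cong (ℕ._* (k ! ℕ.* (n ∸ k) !)) (nCk≡n!/k![n-k]! k≤n)) (m/n*n≡m (k![n∸k]!∣n! k≤n))
  where instance _ = k !* (n ∸ k) !≢0

-- Sequences a stand for the exponential generating functions Σ aₙ zⁿ/n!: then _⋆_ is their
-- product, a ∘ suc is the z-derivative of a, and θ is z d/dz.
module BinomialConvolution {c ℓ} (R : CommutativeRing c ℓ) where
  open CommutativeRing R hiding (zero)
  open PowerSeries rawRing using (Series; _≋_)
  open Multiples R
  open SemiringSum semiring using (sum; sum-cong-≋; ∑-distrib-+; sum-init-last)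
  open CommutativeSemigroupProperties +-commutativeSemigroup using (interchange; x∙yz≈y∙xz)
  open SetoidReasoning setoid

  infixl 7 _⋆_
  _⋆_ : Series → Series → Series
  (f ⋆ g) zero    = f 0 * g 0
  (f ⋆ g) (suc n) = ((f ∘ suc) ⋆ g) n + (f ⋆ (g ∘ suc)) n

  infixl 6 _⊕_
  _⊕_ : Series → Series → Series
  (f ⊕ g) n = f n + g n

  infixr 8 _·_
  _·_ : Carrier → Series → Series
  (a · f) n = a * f n

  θ : Series → Series
  θ f n = n × f n

  ⋆-cong : ∀ {f f′ g g′} → f ≋ f′ → g ≋ g′ → f ⋆ g ≋ f′ ⋆ g′
  ⋆-cong f≋f′ g≋g′ zero    = *-cong (f≋f′ 0) (g≋g′ 0)
  ⋆-cong f≋f′ g≋g′ (suc n) = +-cong (⋆-cong (f≋f′ ∘ suc) g≋g′ n) (⋆-cong f≋f′ (g≋g′ ∘ suc) n)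

  ⋆-comm : ∀ f g → f ⋆ g ≋ g ⋆ f
  ⋆-comm f g zero    = *-comm _ _
  ⋆-comm f g (suc n) = trans (+-cong (⋆-comm (f ∘ suc) g n) (⋆-comm f (g ∘ suc) n)) (+-comm _ _)

  ⋆-distribˡ : ∀ f g h → f ⋆ (g ⊕ h) ≋ f ⋆ g ⊕ f ⋆ h
  ⋆-distribˡ f g h zero    = distribˡ _ _ _
  ⋆-distribˡ f g h (suc n) = trans
    (+-cong (⋆-distribˡ (f ∘ suc) g h n) (⋆-distribˡ f (g ∘ suc) (h ∘ suc) n))
    (interchange _ _ _ _)

  ⋆-distribʳ : ∀ f g h → (g ⊕ h) ⋆ f ≋ g ⋆ f ⊕ h ⋆ f
  ⋆-distribʳ f g h n = trans (⋆-comm (g ⊕ h) f n)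
    (trans (⋆-distribˡ f g h n) (+-cong (⋆-comm f g n) (⋆-comm f h n)))

  -- The recursion for `_⋆_` is the Leibniz rule of d/dz, so both sides differentiate to the same
  -- three products. No identity between binomial coefficients enters.
  ⋆-assoc : ∀ f g h → (f ⋆ g) ⋆ h ≋ f ⋆ (g ⋆ h)
  ⋆-assoc f g h zero    = *-assoc _ _ _
  ⋆-assoc f g h (suc n) = begin
    (((f ∘ suc) ⋆ g ⊕ f ⋆ (g ∘ suc)) ⋆ h) n + ((f ⋆ g) ⋆ (h ∘ suc)) n
      ≈⟨ +-congʳ (⋆-distribʳ h ((f ∘ suc) ⋆ g) (f ⋆ (g ∘ suc)) n) ⟩
    (((f ∘ suc) ⋆ g) ⋆ h) n + ((f ⋆ (g ∘ suc)) ⋆ h) n + ((f ⋆ g) ⋆ (h ∘ suc)) n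
      ≈⟨ +-cong (+-cong (⋆-assoc (f ∘ suc) g h n) (⋆-assoc f (g ∘ suc) h n))
                (⋆-assoc f g (h ∘ suc) n) ⟩
    ((f ∘ suc) ⋆ (g ⋆ h)) n + (f ⋆ ((g ∘ suc) ⋆ h)) n + (f ⋆ (g ⋆ (h ∘ suc))) n
      ≈⟨ +-assoc _ _ _ ⟩
    ((f ∘ suc) ⋆ (g ⋆ h)) n + ((f ⋆ ((g ∘ suc) ⋆ h)) n + (f ⋆ (g ⋆ (h ∘ suc))) n)
      ≈⟨ +-congˡ (⋆-distribˡ f ((g ∘ suc) ⋆ h) (g ⋆ (h ∘ suc)) n) ⟨
    ((f ∘ suc) ⋆ (g ⋆ h)) n + (f ⋆ ((g ∘ suc) ⋆ h ⊕ g ⋆ (h ∘ suc))) n  ∎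

  ⋆-scaleˡ : ∀ a f g → (a · f) ⋆ g ≋ a · (f ⋆ g)
  ⋆-scaleˡ a f g zero    = *-assoc _ _ _
  ⋆-scaleˡ a f g (suc n) =
    trans (+-cong (⋆-scaleˡ a (f ∘ suc) g n) (⋆-scaleˡ a f (g ∘ suc) n)) (sym (distribˡ _ _ _))

  ⋆-scaleʳ : ∀ a f g → f ⋆ (a · g) ≋ a · (f ⋆ g)
  ⋆-scaleʳ a f g n = trans (⋆-comm f (a · g) n)
    (trans (⋆-scaleˡ a g f n) (*-congˡ (⋆-comm g f n)))

  ⋆-zeroˡ : ∀ f g → (∀ n → f n ≈ 0#) → ∀ n → (f ⋆ g) n ≈ 0#
  ⋆-zeroˡ f g f≈0 zero    = trans (*-congʳ (f≈0 0)) (zeroˡ _)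
  ⋆-zeroˡ f g f≈0 (suc n) = trans
    (+-cong (⋆-zeroˡ (f ∘ suc) g (f≈0 ∘ suc) n) (⋆-zeroˡ f (g ∘ suc) f≈0 n)) (+-identityˡ _)

  ⋆-constantˡ : ∀ f g → (∀ n → f (suc n) ≈ 0#) → f ⋆ g ≋ f 0 · g
  ⋆-constantˡ f g f′≈0 zero    = refl
  ⋆-constantˡ f g f′≈0 (suc n) = trans
    (+-cong (⋆-zeroˡ (f ∘ suc) g f′≈0 n) (⋆-constantˡ f (g ∘ suc) f′≈0 n)) (+-identityˡ _)

  -- The induction rests on (d/dz) θ = d/dz + θ (d/dz), which holds by unfolding `suc n × a` to
  -- `a + n × a`. The extra summands `f′g` and `fg′` are what the first term d/dz contributes.
  θ-⋆ : ∀ f g → θ (f ⋆ g) ≋ θ f ⋆ g ⊕ f ⋆ θ g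
  θ-⋆ f g zero    = sym (trans (+-cong (zeroˡ _) (zeroʳ _)) (+-identityˡ _))
  θ-⋆ f g (suc n) = begin
    (f′g + fg′) + n × (f′g + fg′)
      ≈⟨ +-congˡ (×-distrib-+ f′g fg′ n) ⟩
    (f′g + fg′) + (n × f′g + n × fg′)
      ≈⟨ interchange _ _ _ _ ⟩
    (f′g + n × f′g) + (fg′ + n × fg′)
      ≈⟨ +-cong (+-congˡ (θ-⋆ (f ∘ suc) g n)) (+-congˡ (θ-⋆ f (g ∘ suc) n)) ⟩
    (f′g + ((θ (f ∘ suc) ⋆ g) n + ((f ∘ suc) ⋆ θ g) n))
      + (fg′ + ((θ f ⋆ (g ∘ suc)) n + (f ⋆ θ (g ∘ suc)) n))
      ≈⟨ +-cong (+-assoc _ _ _) (x∙yz≈y∙xz _ _ _) ⟨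
    ((f′g + (θ (f ∘ suc) ⋆ g) n) + ((f ∘ suc) ⋆ θ g) n)
      + ((θ f ⋆ (g ∘ suc)) n + (fg′ + (f ⋆ θ (g ∘ suc)) n))
      ≈⟨ interchange _ _ _ _ ⟩
    ((f′g + (θ (f ∘ suc) ⋆ g) n) + (θ f ⋆ (g ∘ suc)) n)
      + (((f ∘ suc) ⋆ θ g) n + (fg′ + (f ⋆ θ (g ∘ suc)) n))
      ≈⟨ +-cong (+-congʳ (⋆-distribʳ g (f ∘ suc) (θ (f ∘ suc)) n))
                (+-congˡ (⋆-distribˡ f (g ∘ suc) (θ (g ∘ suc)) n)) ⟨
    (θ f ⋆ g ⊕ f ⋆ θ g) (suc n)  ∎
    where
    f′g = ((f ∘ suc) ⋆ g) n
    fg′ = (f ⋆ (g ∘ suc)) n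

  -- Iterating the Leibniz rule produces binomial coefficients by Pascal's rule, applied termwise
  -- after the term of index 0 has been split off.
  ⋆-sum : ∀ f g n →
    (f ⋆ g) n ≈ sum {suc n} (λ i → (n choose toℕ i) × (f (toℕ i) * g (n ∸ toℕ i)))
  ⋆-sum f g zero    = sym (trans (+-identityʳ _) (+-identityʳ _))
  ⋆-sum f g (suc n) = begin
    ((f ∘ suc) ⋆ g) n + (f ⋆ (g ∘ suc)) n
      ≈⟨ +-cong (⋆-sum (f ∘ suc) g n) (⋆-sum f (g ∘ suc) n) ⟩
    sum {suc n} s + ((n choose 0) × (f 0 * g (suc n)) + sum {n} t)
      ≈⟨ x∙yz≈y∙xz _ _ _ ⟩
    (n choose 0) × (f 0 * g (suc n)) + (sum {suc n} s + sum {n} t)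
      ≈⟨ +-cong (×-congˡ (≡.trans (nC0≡1 n) (≡.sym (nC0≡1 (suc n))))) (+-congˡ extend) ⟩
    (suc n choose 0) × (f 0 * g (suc n)) + (sum {suc n} s + sum {suc n} (u ∘ toℕ))
      ≈⟨ +-congˡ (∑-distrib-+ s (u ∘ toℕ)) ⟨
    (suc n choose 0) × (f 0 * g (suc n)) + sum {suc n} (λ i → s i + u (toℕ i))
      ≈⟨ +-congˡ (sum-cong-≋ {suc n} λ i → trans
           (sym (×-homo-+ (f (suc (toℕ i)) * g (n ∸ toℕ i)) (n choose toℕ i) _))
           (×-congˡ (nCk+nC[k+1]≡[n+1]C[k+1] n (toℕ i)))) ⟩
    sum {suc (suc n)} (λ i → (suc n choose toℕ i) × (f (toℕ i) * g (suc n ∸ toℕ i)))  ∎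
    where
    s : Fin (suc n) → Carrier
    s i = (n choose toℕ i) × (f (suc (toℕ i)) * g (n ∸ toℕ i))
    t : Fin n → Carrier
    t i = (n choose suc (toℕ i)) × (f (suc (toℕ i)) * g (suc (n ∸ suc (toℕ i))))
    u : ℕ → Carrier
    u i = (n choose suc i) × (f (suc i) * g (n ∸ i))
    t≈u : ∀ i → t i ≈ u (toℕ (inject₁ i))
    t≈u i = ×-cong (≡.cong ((n choose_) ∘ suc) (≡.sym (toℕ-inject₁ i))) (reflexive
      (≡.trans (≡.cong (λ k → f (suc (toℕ i)) * g k) (≡.sym (ℕ.+-∸-assoc 1 (toℕ<n i))))
        (≡.cong (λ k → f (suc k) * g (n ∸ k)) (≡.sym (toℕ-inject₁ i)))))
    u-last≈0 : u (toℕ (fromℕ n)) ≈ 0#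
    u-last≈0 = ×-congˡ (k>n⇒nCk≡0 (≡.subst (λ k → n < suc k) (≡.sym (toℕ-fromℕ n)) (n<1+n n)))
    -- One sum has n + 1 terms and the other n. The padding term carries binom(n, n + 1) = 0, and
    -- the shift from `suc (n ∸ suc i)` to `n ∸ i` is valid because i < n.
    extend : sum {n} t ≈ sum {suc n} (u ∘ toℕ)
    extend = begin
      sum {n} t                                            ≈⟨ sum-cong-≋ {n} t≈u ⟩
      sum {n} (u ∘ toℕ ∘ inject₁)                          ≈⟨ +-identityʳ _ ⟨
      sum {n} (u ∘ toℕ ∘ inject₁) + 0#                     ≈⟨ +-congˡ u-last≈0 ⟨
      sum {n} (u ∘ toℕ ∘ inject₁) + u (toℕ (fromℕ n))      ≈⟨ sum-init-last (u ∘ toℕ {suc n}) ⟨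
      sum {suc n} (u ∘ toℕ)                                ∎

  -- The hats are ordinary power series coefficients, f̂ n standing for f n / n!. The hypotheses say
  -- so by multiplication, and n! = binom(n, k) k! (n - k)! distributes the factor over each
  -- product.
  cauchy-product : ∀ (f g f̂ ĝ : Series) →
    (∀ n → (n !) × f̂ n ≈ f n) → (∀ n → (n !) × ĝ n ≈ g n) → ∀ n →
    (n !) × sum {suc n} (λ i → f̂ (toℕ i) * ĝ (n ∸ toℕ i)) ≈ (f ⋆ g) n
  cauchy-product f g f̂ ĝ f̂-egf ĝ-egf n = begin
    (n !) × sum {suc n} (λ i → f̂ (toℕ i) * ĝ (n ∸ toℕ i))
      ≈⟨ ×-distrib-sum {suc n} (n !) (λ i → f̂ (toℕ i) * ĝ (n ∸ toℕ i)) ⟩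
    sum {suc n} (λ i → (n !) × (f̂ (toℕ i) * ĝ (n ∸ toℕ i)))
      ≈⟨ sum-cong-≋ {suc n} term ⟩
    sum {suc n} (λ i → (n choose toℕ i) × (f (toℕ i) * g (n ∸ toℕ i)))
      ≈⟨ ⋆-sum f g n ⟨
    (f ⋆ g) n  ∎
    where
    term : ∀ (i : Fin (suc n)) → (n !) × (f̂ (toℕ i) * ĝ (n ∸ toℕ i)) ≈
      (n choose toℕ i) × (f (toℕ i) * g (n ∸ toℕ i))
    term i = begin
      (n !) × (f̂ k * ĝ (n ∸ k))
        ≈⟨ ×-congˡ (nCk*k![n∸k]!≡n! (s≤s⁻¹ (toℕ<n i))) ⟨
      ((n choose k) ℕ.* (k ! ℕ.* (n ∸ k) !)) × (f̂ k * ĝ (n ∸ k))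
        ≈⟨ ×-assocˡ _ (n choose k) _ ⟨
      (n choose k) × ((k ! ℕ.* (n ∸ k) !) × (f̂ k * ĝ (n ∸ k)))
        ≈⟨ ×-congʳ (n choose k) (×-interchange (k !) ((n ∸ k) !) _ _) ⟩
      (n choose k) × (((k !) × f̂ k) * (((n ∸ k) !) × ĝ (n ∸ k)))
        ≈⟨ ×-congʳ (n choose k) (*-cong (f̂-egf k) (ĝ-egf (n ∸ k))) ⟩
      (n choose k) × (f k * g (n ∸ k))  ∎
      where k = toℕ i

-- Long division of power series

module SeriesDivision {c ℓ} (R : CommutativeRing c ℓ) where
  open CommutativeRing R hiding (zero)
  open PowerSeries rawRing
  open SemiringSum semiring using (sum; sum-cong-≋)
  open SetoidReasoning setoid

  -- Each division step only prepends a coefficient, so those found earlier never change.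
  quotients-lookup : ∀ f g n i → quotients f g n i ≡ (f ÷ g) (n ∸ suc (toℕ i))
  quotients-lookup f g (suc n) zero    = ≡.refl
  quotients-lookup f g (suc n) (suc i) = quotients-lookup f g n i

  ÷-correct : ∀ f g → g 0 ≈ 1# → ∀ n →
    sum {suc n} (λ i → g (toℕ i) * (f ÷ g) (n ∸ toℕ i)) ≈ f n
  ÷-correct f g g₀≈1 n = begin
    g 0 * (f n + - s) + sum {n} (λ i → g (suc (toℕ i)) * (f ÷ g) (n ∸ suc (toℕ i)))
      ≈⟨ +-cong (trans (*-congʳ g₀≈1) (*-identityˡ _))
           (sum-cong-≋ {n} λ i →
             trans (*-comm _ _) (*-congʳ (reflexive (≡.sym (quotients-lookup f g n i))))) ⟩
    f n + - s + s      ≈⟨ +-assoc _ _ _ ⟩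
    f n + (- s + s)    ≈⟨ +-congˡ (-‿inverseˡ s) ⟩
    f n + 0#           ≈⟨ +-identityʳ _ ⟩
    f n                ∎
    where s = sum {n} (λ i → quotients f g n i * g (suc (toℕ i)))

-- Derivations and logarithmic derivatives

record IsDerivation {c ℓ} (R : CommutativeRing c ℓ)
  (D : CommutativeRing.Carrier R → CommutativeRing.Carrier R) : Set (c ⊔ ℓ) where
  open CommutativeRing R
  field
    D-cong  : ∀ {a b} → a ≈ b → D a ≈ D b
    D-+     : ∀ a b → D (a + b) ≈ D a + D b
    D-*     : ∀ a b → D (a * b) ≈ D a * b + a * D b

module Derivation {c ℓ} (R : CommutativeRing c ℓ) {D} (isDerivation : IsDerivation R D) where
  open CommutativeRing R hiding (zero)
  open IsDerivation isDerivation public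
  open PowerSeries rawRing using (Series; _≋_; _÷_)
  open BinomialConvolution R
  open Multiples R using (_×_; ×-congʳ)
  open SemiringSum semiring using (sum)
  open SeriesDivision R using (÷-correct)
  open CommutativeSemigroupProperties +-commutativeSemigroup using (interchange)
  open GroupProperties +-group using (inverseˡ-unique)
  open RingProperties ring using (x+x≈x⇒x≈0)
  open SetoidReasoning setoid

  D-0# : D 0# ≈ 0#
  D-0# = x+x≈x⇒x≈0 _ (trans (sym (D-+ 0# 0#)) (D-cong (+-identityˡ 0#)))

  D-1# : D 1# ≈ 0#
  D-1# = x+x≈x⇒x≈0 _ (begin
    D 1# + D 1#              ≈⟨ +-cong (*-identityʳ _) (*-identityˡ _) ⟨
    D 1# * 1# + 1# * D 1#    ≈⟨ D-* 1# 1# ⟨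
    D (1# * 1#)              ≈⟨ D-cong (*-identityˡ 1#) ⟩
    D 1#                     ∎)

  D-neg : ∀ a → D (- a) ≈ - D a
  D-neg a = inverseˡ-unique _ _
    (trans (sym (D-+ (- a) a)) (trans (D-cong (-‿inverseˡ a)) D-0#))

  D-× : ∀ n a → D (n × a) ≈ n × D a
  D-× zero    a = D-0#
  D-× (suc n) a = trans (D-+ _ _) (+-congˡ (D-× n a))

  D-⋆ : ∀ f g → D ∘ (f ⋆ g) ≋ (D ∘ f) ⋆ g ⊕ f ⋆ (D ∘ g)
  D-⋆ f g zero    = D-* _ _
  D-⋆ f g (suc n) = trans (D-+ _ _)
    (trans (+-cong (D-⋆ (f ∘ suc) g n) (D-⋆ f (g ∘ suc) n)) (interchange _ _ _ _))

  -- This is f̂ · (D f̂ / f̂) = D f̂ with n! multiplied in. It replaces the long division by an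
  -- equation in `_⋆_`, the only property of the logarithmic derivative used from here on.
  ⋆-logarithmic-derivative : ∀ f f̂ → (∀ n → (n !) × f̂ n ≈ f n) → f̂ 0 ≈ 1# →
    f ⋆ (λ n → (n !) × ((D ∘ f̂) ÷ f̂) n) ≋ D ∘ f
  ⋆-logarithmic-derivative f f̂ f̂-egf f̂₀≈1 n = begin
    (f ⋆ (λ n → (n !) × q n)) n
      ≈⟨ cauchy-product f (λ n → (n !) × q n) f̂ q f̂-egf (λ _ → refl) n ⟨
    (n !) × sum {suc n} (λ i → f̂ (toℕ i) * q (n ∸ toℕ i))
      ≈⟨ ×-congʳ (n !) (÷-correct (D ∘ f̂) f̂ f̂₀≈1 n) ⟩
    (n !) × D (f̂ n)    ≈⟨ D-× (n !) (f̂ n) ⟨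
    D ((n !) × f̂ n)    ≈⟨ D-cong (f̂-egf n) ⟩
    D (f n)            ∎
    where
    q : Series
    q = (D ∘ f̂) ÷ f̂

-- The second-order Eulerian recurrence and the reciprocal series

record IsSecondOrderEulerian {c ℓ} (R : CommutativeRing c ℓ)
  (D : CommutativeRing.Carrier R → CommutativeRing.Carrier R)
  (x : CommutativeRing.Carrier R) (C : ℕ → CommutativeRing.Carrier R) : Set (c ⊔ ℓ) where
  open CommutativeRing R
  open Multiples R using (_×_)
  field
    isDerivation : IsDerivation R D
    D-x          : D x ≈ 1#
    C-zero       : C 0 ≈ 1#
    C-suc        : ∀ n → C (suc n) ≈
      (2 ℕ.* suc n ∸ 1) × (x * C n) + x * (1# + - x) * D (C n)

module SecondOrderEulerian {c ℓ} (R : CommutativeRing c ℓ) {D x C}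
  (isSecondOrderEulerian : IsSecondOrderEulerian R D x C) where
  open CommutativeRing R hiding (zero)
  open Multiples R
  open IsSecondOrderEulerian isSecondOrderEulerian
  open Derivation R isDerivation
  open PowerSeries rawRing using (Series; _≋_)
  open BinomialConvolution R
  open SemiringSum semiring using (sum; sum-cong-≋)
  open RingProperties ring using (-1*x≈-x; -‿distribʳ-*; +-cancelʳ)
  open GroupProperties +-group using (⁻¹-involutive; inverseˡ-unique; ε⁻¹≈ε)
  open Determinant rawRing using (det)
  open HessenbergDeterminant R using (matrix; IsHessenberg; det≈solution)
  open Solver commutativeSemiring using (solve; con; _:+_; _:*_; _:=_)
  open SetoidReasoning setoid

  -- Minus n! times the coefficient of zⁿ in 1 / C, in the closed form F.
  E : Series
  E zero          = - 1#
  E (suc zero)    = x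
  E (suc (suc n)) = C (suc n)

  y : Carrier
  y = x * (1# + - x)

  D-[-1#] : D (- 1#) ≈ 0#
  D-[-1#] = trans (D-neg 1#) (trans (-‿cong D-1#) ε⁻¹≈ε)

  -- Splitting 2n + 1 as n + n + 1 turns the factor that varies with n into the operator `θ`, so
  -- that the recurrence becomes an identity between whole series.
  C-θ : ∀ n → C (suc n) ≈ x * θ C n + x * θ C n + x * C n + y * D (C n)
  C-θ n = trans (C-suc n) (+-congʳ (begin
    (n ℕ.+ suc (n ℕ.+ 0)) × (x * C n)
      ≈⟨ ×-homo-+ (x * C n) n (suc (n ℕ.+ 0)) ⟩
    n × (x * C n) + (x * C n + (n ℕ.+ 0) × (x * C n))
      ≈⟨ +-congˡ (+-congˡ (trans (×-homo-+ (x * C n) n 0) (+-identityʳ _))) ⟩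
    n × (x * C n) + (x * C n + n × (x * C n))
      ≈⟨ +-cong (×-comm-* n x (C n)) (+-congˡ (×-comm-* n x (C n))) ⟨
    x * θ C n + (x * C n + x * θ C n)
      ≈⟨ solve 2 (λ a b → a :+ (b :+ a) := a :+ a :+ b) refl (x * θ C n) (x * C n) ⟩
    x * θ C n + x * θ C n + x * C n  ∎))

  -- From index 2 on, `E` is `C` moved up by one place, so `θ E` exceeds `θ C` by one copy of `C`.
  -- Since `θ` occurs twice, x C turns into x C - 2 x C = - x C. At the bottom, `E 1 = x` is the
  -- value that the recurrence yields from `E 0 = - 1#`. The negative term stands on the left
  -- because the solver works in semirings.
  E-θ : ∀ n → E (suc n) + x * E n ≈ x * θ E n + x * θ E n + y * D (E n)
  E-θ zero          = begin
    x + x * - 1#                      ≈⟨ +-congˡ (-‿distribʳ-* x 1#) ⟨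
    x + - (x * 1#)                    ≈⟨ +-congˡ (-‿cong (*-identityʳ x)) ⟩
    x + - x                           ≈⟨ -‿inverseʳ x ⟩
    0#                                ≈⟨ solve 2 (λ x y → con 0 := x :* con 0 :+ x :* con 0 :+ y :* con 0) refl x y ⟩
    x * 0# + x * 0# + y * 0#          ≈⟨ +-congˡ (*-congˡ D-[-1#]) ⟨
    x * 0# + x * 0# + y * D (- 1#)    ∎
  E-θ (suc zero)    = begin
    C 1 + x * x
      ≈⟨ +-congʳ (C-suc 0) ⟩
    1 × (x * C 0) + y * D (C 0) + x * x
      ≈⟨ +-congʳ (+-cong (×-congʳ 1 (*-congˡ C-zero)) (*-congˡ (trans (D-cong C-zero) D-1#))) ⟩
    1 × (x * 1#) + y * 0# + x * x
      ≈⟨ solve 2 (λ x y → (x :* con 1 :+ con 0) :+ y :* con 0 :+ x :* x := x :* (con 1 :+ con 0) :+ x :* x)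
         refl x y ⟩
    x * (1# + 0#) + x * x
      -- A zero is inserted to make the factor 1 - x of `y` appear; the solver then treats `- x` as
      -- an independent variable.
      ≈⟨ +-congʳ (*-congˡ (+-congˡ (-‿inverseˡ x))) ⟨
    x * (1# + (- x + x)) + x * x
      ≈⟨ solve 2 (λ x -x → x :* (con 1 :+ (-x :+ x)) :+ x :* x
           := x :* (x :+ con 0) :+ x :* (x :+ con 0) :+ x :* (con 1 :+ -x) :* con 1)
         refl x (- x) ⟩
    x * (1 × x) + x * (1 × x) + y * 1#
      ≈⟨ +-congˡ (*-congˡ D-x) ⟨
    x * (1 × x) + x * (1 × x) + y * D x  ∎
  E-θ (suc (suc n)) = begin
    C (2 ℕ.+ n) + x * C (suc n)
      ≈⟨ +-congʳ (C-θ (suc n)) ⟩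
    x * θ C (suc n) + x * θ C (suc n) + x * C (suc n) + y * D (C (suc n)) + x * C (suc n)
      ≈⟨ solve 4 (λ x t c d →
           x :* t :+ x :* t :+ x :* c :+ d :+ x :* c := x :* (c :+ t) :+ x :* (c :+ t) :+ d)
         refl x (θ C (suc n)) (C (suc n)) (y * D (C (suc n))) ⟩
    x * θ E (2 ℕ.+ n) + x * θ E (2 ℕ.+ n) + y * D (E (2 ℕ.+ n))  ∎

  -- The term `x * P` is added to both sides: on the left it completes the equation for `E`, on the
  -- right the equation for `C` supplies it. The rest recombines because `θ` and `D` are both
  -- derivations for `_⋆_`.
  E⋆C-suc : ∀ n → (E ⋆ C) (suc n) ≈ x * θ (E ⋆ C) n + x * θ (E ⋆ C) n + y * D ((E ⋆ C) n)
  E⋆C-suc n = +-cancelʳ (x * P) _ _ (begin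
    ((E ∘ suc) ⋆ C) n + (E ⋆ (C ∘ suc)) n + x * P
      ≈⟨ solve 3 (λ a b c → a :+ b :+ c := (a :+ c) :+ b) refl _ _ _ ⟩
    (((E ∘ suc) ⋆ C) n + x * P) + (E ⋆ (C ∘ suc)) n
      ≈⟨ +-cong left right ⟩
    (x * (θ E ⋆ C) n + x * (θ E ⋆ C) n + y * ((D ∘ E) ⋆ C) n)
      + (x * (E ⋆ θ C) n + x * (E ⋆ θ C) n + x * P + y * (E ⋆ (D ∘ C)) n)
      ≈⟨ solve 7 (λ x y a b c d p →
           (x :* a :+ x :* a :+ y :* b) :+ (x :* c :+ x :* c :+ p :+ y :* d)
             := x :* (a :+ c) :+ x :* (a :+ c) :+ y :* (b :+ d) :+ p)
         refl x y ((θ E ⋆ C) n) (((D ∘ E) ⋆ C) n) ((E ⋆ θ C) n) ((E ⋆ (D ∘ C)) n) (x * P) ⟩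
    x * (θ E ⋆ C ⊕ E ⋆ θ C) n + x * (θ E ⋆ C ⊕ E ⋆ θ C) n
      + y * ((D ∘ E) ⋆ C ⊕ E ⋆ (D ∘ C)) n + x * P
      ≈⟨ +-congʳ (+-cong (+-cong (*-congˡ (θ-⋆ E C n)) (*-congˡ (θ-⋆ E C n))) (*-congˡ (D-⋆ E C n))) ⟨
    x * θ (E ⋆ C) n + x * θ (E ⋆ C) n + y * D ((E ⋆ C) n) + x * P  ∎)
    where
    P : Carrier
    P = (E ⋆ C) n
    left : ((E ∘ suc) ⋆ C) n + x * P ≈ x * (θ E ⋆ C) n + x * (θ E ⋆ C) n + y * ((D ∘ E) ⋆ C) n
    left = begin
      ((E ∘ suc) ⋆ C) n + x * P
        ≈⟨ +-congˡ (⋆-scaleˡ x E C n) ⟨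
      ((E ∘ suc) ⋆ C) n + ((x · E) ⋆ C) n
        ≈⟨ ⋆-distribʳ C (E ∘ suc) (x · E) n ⟨
      ((E ∘ suc ⊕ x · E) ⋆ C) n
        ≈⟨ ⋆-cong {E ∘ suc ⊕ x · E} {x · θ E ⊕ x · θ E ⊕ y · (D ∘ E)} {C} {C} E-θ (λ _ → refl) n ⟩
      ((x · θ E ⊕ x · θ E ⊕ y · (D ∘ E)) ⋆ C) n
        ≈⟨ ⋆-distribʳ C (x · θ E ⊕ x · θ E) (y · (D ∘ E)) n ⟩
      ((x · θ E ⊕ x · θ E) ⋆ C) n + ((y · (D ∘ E)) ⋆ C) n
        ≈⟨ +-cong (⋆-distribʳ C (x · θ E) (x · θ E) n) (⋆-scaleˡ y (D ∘ E) C n) ⟩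
      ((x · θ E) ⋆ C) n + ((x · θ E) ⋆ C) n + y * ((D ∘ E) ⋆ C) n
        ≈⟨ +-congʳ (+-cong (⋆-scaleˡ x (θ E) C n) (⋆-scaleˡ x (θ E) C n)) ⟩
      x * (θ E ⋆ C) n + x * (θ E ⋆ C) n + y * ((D ∘ E) ⋆ C) n  ∎
    right : (E ⋆ (C ∘ suc)) n ≈
      x * (E ⋆ θ C) n + x * (E ⋆ θ C) n + x * P + y * (E ⋆ (D ∘ C)) n
    right = begin
      (E ⋆ (C ∘ suc)) n
        ≈⟨ ⋆-cong {E} {E} {C ∘ suc} {x · θ C ⊕ x · θ C ⊕ x · C ⊕ y · (D ∘ C)} (λ _ → refl) C-θ n ⟩
      (E ⋆ (x · θ C ⊕ x · θ C ⊕ x · C ⊕ y · (D ∘ C))) n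
        ≈⟨ ⋆-distribˡ E (x · θ C ⊕ x · θ C ⊕ x · C) (y · (D ∘ C)) n ⟩
      (E ⋆ (x · θ C ⊕ x · θ C ⊕ x · C)) n + (E ⋆ (y · (D ∘ C))) n
        ≈⟨ +-congʳ (⋆-distribˡ E (x · θ C ⊕ x · θ C) (x · C) n) ⟩
      (E ⋆ (x · θ C ⊕ x · θ C)) n + (E ⋆ (x · C)) n + (E ⋆ (y · (D ∘ C))) n
        ≈⟨ +-congʳ (+-congʳ (⋆-distribˡ E (x · θ C) (x · θ C) n)) ⟩
      (E ⋆ (x · θ C)) n + (E ⋆ (x · θ C)) n + (E ⋆ (x · C)) n + (E ⋆ (y · (D ∘ C))) n
        ≈⟨ +-cong (+-cong (+-cong (⋆-scaleʳ x E (θ C) n) (⋆-scaleʳ x E (θ C) n))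
             (⋆-scaleʳ x E C n)) (⋆-scaleʳ y E (D ∘ C) n) ⟩
      x * (E ⋆ θ C) n + x * (E ⋆ θ C) n + x * P + y * (E ⋆ (D ∘ C)) n  ∎

  E⋆C-zero : (E ⋆ C) 0 ≈ - 1#
  E⋆C-zero = trans (*-congˡ C-zero) (*-identityʳ _)

  -- Mutual induction: each coefficient is determined by `θ` and `D` of the previous one. The
  -- initial coefficient -1 is killed by `θ` through the factor 0, and by `D` as a constant.
  D-E⋆C : ∀ n → D ((E ⋆ C) n) ≈ 0#
  E⋆C≈0 : ∀ n → (E ⋆ C) (suc n) ≈ 0#
  E⋆C≈0 n = trans (E⋆C-suc n) (begin
    x * θ (E ⋆ C) n + x * θ (E ⋆ C) n + y * D ((E ⋆ C) n)
      ≈⟨ +-cong (+-cong (*-congˡ (θ≈0 n)) (*-congˡ (θ≈0 n))) (*-congˡ (D-E⋆C n)) ⟩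
    x * 0# + x * 0# + y * 0#
      ≈⟨ solve 2 (λ x y → x :* con 0 :+ x :* con 0 :+ y :* con 0 := con 0) refl x y ⟩
    0#  ∎)
    where
    θ≈0 : ∀ n → θ (E ⋆ C) n ≈ 0#
    θ≈0 zero    = refl
    θ≈0 (suc n) = trans (×-congʳ (suc n) (E⋆C≈0 n)) (×-zeroʳ (suc n))

  D-E⋆C zero    = trans (D-cong E⋆C-zero) D-[-1#]
  D-E⋆C (suc n) = trans (D-cong (E⋆C≈0 n)) D-0#

  E⋆C⋆ : ∀ f n → ((E ⋆ C) ⋆ f) n ≈ - f n
  E⋆C⋆ f n = trans (⋆-constantˡ (E ⋆ C) f E⋆C≈0 n) (trans (*-congʳ E⋆C-zero) (-1*x≈-x _))

  module _ (L : Series) (C⋆L : C ⋆ L ≋ D ∘ C) where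

    E⋆DC : ∀ n → (E ⋆ (D ∘ C)) n ≈ - L n
    E⋆DC n = begin
      (E ⋆ (D ∘ C)) n    ≈⟨ ⋆-cong {E} {E} {C ⋆ L} {D ∘ C} (λ _ → refl) C⋆L n ⟨
      (E ⋆ (C ⋆ L)) n    ≈⟨ ⋆-assoc E C L n ⟨
      ((E ⋆ C) ⋆ L) n    ≈⟨ E⋆C⋆ L n ⟩
      - L n              ∎

    -- Since E C is constant, differentiating it in x gives E_x C = - E C_x.
    C⋆DE : C ⋆ (D ∘ E) ≋ L
    C⋆DE n = begin
      (C ⋆ (D ∘ E)) n              ≈⟨ ⋆-comm C (D ∘ E) n ⟩
      ((D ∘ E) ⋆ C) n              ≈⟨ inverseˡ-unique _ _ (trans (sym (D-⋆ E C n)) (D-E⋆C n)) ⟩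
      - (E ⋆ (D ∘ C)) n            ≈⟨ -‿cong (E⋆DC n) ⟩
      - - L n                      ≈⟨ ⁻¹-involutive _ ⟩
      L n                          ∎

    E⋆L : ∀ n → (E ⋆ L) n ≈ - D (E n)
    E⋆L n = begin
      (E ⋆ L) n                ≈⟨ ⋆-cong {E} {E} {C ⋆ (D ∘ E)} {L} (λ _ → refl) C⋆DE n ⟨
      (E ⋆ (C ⋆ (D ∘ E))) n    ≈⟨ ⋆-assoc E C (D ∘ E) n ⟨
      ((E ⋆ C) ⋆ (D ∘ E)) n    ≈⟨ E⋆C⋆ (D ∘ E) n ⟩
      - D (E n)                ∎

  -- The two linear systems and their determinants

  module _ (h : ℕ → ℕ → Carrier)
    (lower : ∀ {i j} → j ≤ i → h i j ≈ (suc i choose suc j) × E (i ∸ j))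
    (above : ∀ {i j} → i < j → h i j ≈ 0#)
    where

    isHessenberg : IsHessenberg h
    isHessenberg = record
      { diagonal = λ i → begin
          h i i                                ≈⟨ lower ≤-refl ⟩
          (suc i choose suc i) × E (i ∸ i)     ≈⟨ ×-cong (nCn≡1 (suc i)) (reflexive (≡.cong E (n∸n≡0 i))) ⟩
          1 × - 1#                             ≈⟨ +-identityʳ _ ⟩
          - 1#                                 ∎
      ; above    = above
      }

    -- Written as u E, the product has the index of the unknown as summation index. Its coefficient
    -- m + 1 has m + 2 terms; the one with `u 0` vanishes, and the others form row m of `h` applied
    -- to u 1, ..., u (m + 1).
    E⋆-system : ∀ (u a : Series) → u 0 ≈ 0# → (∀ n → (E ⋆ u) n ≈ - a n) → ∀ m →
      sum {suc m} (λ j → h m (toℕ j) * u (suc (toℕ j))) ≈ - a (suc m)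
    E⋆-system u a u₀≈0 E⋆u m = begin
      sum {suc m} (λ j → h m (toℕ j) * u (suc (toℕ j)))
        ≈⟨ sum-cong-≋ {suc m} term ⟩
      sum {suc m} (λ j → (suc m choose suc (toℕ j)) × (u (suc (toℕ j)) * E (m ∸ toℕ j)))
        ≈⟨ +-identityˡ _ ⟨
      0# + sum {suc m} (λ j → (suc m choose suc (toℕ j)) × (u (suc (toℕ j)) * E (m ∸ toℕ j)))
        ≈⟨ +-congʳ (trans (×-congˡ (nC0≡1 (suc m)))
             (trans (+-identityʳ _) (trans (*-congʳ u₀≈0) (zeroˡ (E (suc m)))))) ⟨
      sum {suc (suc m)} (λ j → (suc m choose toℕ j) × (u (toℕ j) * E (suc m ∸ toℕ j)))
        ≈⟨ ⋆-sum u E (suc m) ⟨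
      (u ⋆ E) (suc m)
        ≈⟨ ⋆-comm u E (suc m) ⟩
      (E ⋆ u) (suc m)
        ≈⟨ E⋆u (suc m) ⟩
      - a (suc m)  ∎
      where
      term : ∀ (j : Fin (suc m)) → h m (toℕ j) * u (suc (toℕ j)) ≈
        (suc m choose suc (toℕ j)) × (u (suc (toℕ j)) * E (m ∸ toℕ j))
      term j = begin
        h m k * u (suc k)                                    ≈⟨ *-congʳ (lower (s≤s⁻¹ (toℕ<n j))) ⟩
        (suc m choose suc k) × E (m ∸ k) * u (suc k)         ≈⟨ ×-assoc-* (suc m choose suc k) _ _ ⟩
        (suc m choose suc k) × (E (m ∸ k) * u (suc k))       ≈⟨ ×-congʳ (suc m choose suc k) (*-comm _ _) ⟩
        (suc m choose suc k) × (u (suc k) * E (m ∸ k))       ∎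
        where k = toℕ j

    det≈ : ∀ (u a : Series) → u 0 ≈ 0# → (∀ n → (E ⋆ u) n ≈ - a n) → ∀ n →
      det (matrix (a ∘ suc) h (suc n)) ≈ u (suc n)
    det≈ u a u₀≈0 E⋆u = det≈solution isHessenberg (a ∘ suc) (u ∘ suc) (E⋆-system u a u₀≈0 E⋆u)

    module _ (L : Series) (C⋆L : C ⋆ L ≋ D ∘ C) where

      DC₀≈0 : D (C 0) ≈ 0#
      DC₀≈0 = trans (D-cong C-zero) D-1#

      L₀≈0 : L 0 ≈ 0#
      L₀≈0 = begin
        L 0          ≈⟨ *-identityˡ _ ⟨
        1# * L 0     ≈⟨ *-congʳ C-zero ⟨
        C 0 * L 0    ≈⟨ C⋆L 0 ⟩
        D (C 0)      ≈⟨ DC₀≈0 ⟩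
        0#           ∎

      D-C≈det : ∀ n → det (matrix (L ∘ suc) h (suc n)) ≈ D (C (suc n))
      D-C≈det = det≈ (D ∘ C) L DC₀≈0 (E⋆DC L C⋆L)

      -- `L` passes from right-hand side to unknown, and the new right-hand side is `D ∘ E`.
      L≈det : ∀ n → det (matrix (D ∘ E ∘ suc) h (suc n)) ≈ L (suc n)
      L≈det = det≈ L (D ∘ E) L₀≈0 (E⋆L L C⋆L)

-- Rational coefficients and the concrete matrices

open import Data.Integer.Base as ℤ using (+_)
import Data.Integer.Properties as ℤ
open import Data.Product.Base using (_×_)
open import Data.Rational.Base as ℚ using (ℚ)
import Data.Rational.Properties as ℚ
import Data.Rational.Unnormalised.Base as ℚᵘ
import Data.Rational.Unnormalised.Properties as ℚᵘ
open import Relation.Binary.PropositionalEquality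
  using (refl; sym; trans; cong; module ≡-Reasoning)
open import Defs

open PolynomialRing ℚ.+-*-commutativeRing
module ℚ× = Multiples ℚ.+-*-commutativeRing
open Multiples polyRing using () renaming (_×_ to _×ₚ_)

module _ where
  open ℚᵘ.≃-Reasoning

  -- The number of copies is freed from the denominator to allow induction with d fixed.
  -- Unnormalised fractions avoid the reduction to lowest terms at every step.
  toℚᵘ-×-1/ : ∀ m d .{{_ : NonZero d}} → ℚ.toℚᵘ (m ℚ×.× (+ 1 ℚ./ d)) ℚᵘ.≃ + m ℚᵘ./ d
  toℚᵘ-×-1/ zero    (suc d) = ℚᵘ.*≡* refl
  toℚᵘ-×-1/ (suc m) (suc d) = begin
    ℚ.toℚᵘ (q ℚ.+ m ℚ×.× q)
      ≈⟨ ℚ.toℚᵘ-homo-+ q (m ℚ×.× q) ⟩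
    ℚ.toℚᵘ q ℚᵘ.+ ℚ.toℚᵘ (m ℚ×.× q)
      ≈⟨ ℚᵘ.+-cong (ℚ.toℚᵘ-fromℚᵘ (ℚᵘ.mkℚᵘ (+ 1) d)) (toℚᵘ-×-1/ m (suc d)) ⟩
    ℚᵘ.mkℚᵘ (+ 1) d ℚᵘ.+ ℚᵘ.mkℚᵘ (+ m) d
      ≈⟨ ℚᵘ.*≡* (trans (cong (ℤ._* (+ suc d)) (sym (ℤ.*-distribʳ-+ (+ suc d) (+ 1) (+ m))))
           (ℤ.*-assoc (+ suc m) (+ suc d) (+ suc d))) ⟩
    ℚᵘ.mkℚᵘ (+ suc m) d  ∎
    where q = + 1 ℚ./ suc d

  ×-1/ : ∀ d .{{_ : NonZero d}} → d ℚ×.× (+ 1 ℚ./ d) ≡ ℚ.1ℚ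
  ×-1/ d@(suc d-1) = ℚ.toℚᵘ-injective (ℚᵘ.≃-trans (toℚᵘ-×-1/ d d)
    (ℚᵘ.*≡* (trans (ℤ.*-identityʳ (+ d)) (sym (ℤ.*-identityˡ (+ d))))))

coeff-× : ∀ m p k → coeff (m ×ₚ p) k ≡ m ℚ×.× coeff p k
coeff-× zero    p k = refl
coeff-× (suc m) p k = trans (coeff-+ p (m ×ₚ p) k) (cong (coeff p k ℚ.+_) (coeff-× m p k))

n!×egf : ∀ a n → (n !) ×ₚ egf a n ≈ a n
n!×egf a n k = begin
  coeff ((n !) ×ₚ egf a n) k            ≡⟨ coeff-× (n !) (egf a n) k ⟩
  (n !) ℚ×.× coeff (egf a n) k          ≡⟨ cong ((n !) ℚ×.×_) (coeff-scale (1/ n !) (a n) k) ⟩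
  (n !) ℚ×.× (1/ n ! ℚ.* coeff (a n) k) ≡⟨ ℚ×.×-assoc-* (n !) (1/ n !) _ ⟨
  (n !) ℚ×.× (1/ n !) ℚ.* coeff (a n) k ≡⟨ cong (ℚ._* coeff (a n) k) (×-1/ (n !) {{n !≢0}}) ⟩
  ℚ.1ℚ ℚ.* coeff (a n) k                ≡⟨ ℚ.*-identityˡ _ ⟩
  coeff (a n) k                         ∎
  where open ≡-Reasoning

deriv-isDerivation : IsDerivation polyRing deriv
deriv-isDerivation = record
  { D-cong = λ {p} {q} → deriv-cong p q
  ; D-+    = deriv-+
  ; D-*    = deriv-*
  }

deriv-X : deriv X ≈ 1#
deriv-X k = refl

open BinomialConvolution polyRing using (_⋆_)
open Derivation polyRing deriv-isDerivation using (⋆-logarithmic-derivative)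
open HessenbergDeterminant polyRing using (matrix; det-cong)

C-isSecondOrderEulerian : IsSecondOrderEulerian polyRing deriv X C
C-isSecondOrderEulerian = record
  { isDerivation = deriv-isDerivation
  ; D-x          = deriv-X
  ; C-zero       = λ _ → refl
  ; C-suc        = λ _ _ → refl
  }

open SecondOrderEulerian polyRing C-isSecondOrderEulerian

module ℕ+ = CommutativeSemigroupProperties ℕ.+-commutativeSemigroup

m+n+o∸n≡m+o : ∀ m n o → m ℕ.+ (n ℕ.+ o) ∸ n ≡ m ℕ.+ o
m+n+o∸n≡m+o m n o = trans (cong (_∸ n) (ℕ+.x∙yz≈y∙xz m n o)) (m+n∸m≡n n (m ℕ.+ o))

-- The offset `suc i ∸ j` is 0 on the superdiagonal, 1 on the diagonal and at least 2 below,
-- matching the three clauses of `E`.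
entry≡ : ∀ i j → j ≤ suc i → entry i j ≡ (i choose (j ∸ 1)) ×ₚ E (suc i ∸ j)
entry≡ i j j≤1+i with ℕ.compare i j
... | ℕ.less _ zero    rewrite ℕ.+-identityʳ i | nCn≡1 i | n∸n≡0 i = refl
... | ℕ.less _ (suc k) = contradiction j≤1+i (<⇒≱ (s≤s (m<m+n i z<s)))
... | ℕ.equal _        rewrite m+n∸n≡m 1 i = refl
-- Here i is j + k + 1, and `C (i ∸ j)` and `E (suc i ∸ j)` both become `C (suc k)`.
... | ℕ.greater _ k    rewrite m+n+o∸n≡m+o 1 j k | m+n+o∸n≡m+o 2 j k = refl

entry≡0 : ∀ i j → suc i < j → entry i j ≡ 0#
entry≡0 i j 1+i<j with ℕ.compare i j
... | ℕ.less _ zero    = contradiction 1+i<j (<-irrefl (cong suc (sym (ℕ.+-identityʳ i))))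
... | ℕ.less _ (suc k) = refl
... | ℕ.equal _        = contradiction 1+i<j (≤⇒≯ (n≤1+n i))
... | ℕ.greater _ k    = contradiction 1+i<j (≤⇒≯ (m≤n⇒m≤1+n (m≤n⇒m≤1+n (m≤m+n j k))))

-- The column index is shifted by two: one for counting from 0, one for the first column, which is
-- kept apart.
entries : ℕ → ℕ → Poly
entries i j = entry (suc i) (suc (suc j))

entries-lower : ∀ {i j} → j ≤ i → entries i j ≈ (suc i choose suc j) ×ₚ E (i ∸ j)
entries-lower {i} {j} j≤i k = cong (λ p → coeff p k) (entry≡ (suc i) (suc (suc j)) (s≤s (s≤s j≤i)))

entries-above : ∀ {i j} → i < j → entries i j ≈ 0#
entries-above {i} {j} i<j k = cong (λ p → coeff p k) (entry≡0 (suc i) (suc (suc j)) (s<s (s<s i<j)))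

egfC₀≈1 : egfC 0 ≈ 1#
egfC₀≈1 zero    = refl
egfC₀≈1 (suc k) = refl

C⋆L : C ⋆ L ≋ deriv ∘ C
C⋆L = ⋆-logarithmic-derivative C egfC (n!×egf C) egfC₀≈1

matrixL≈ : ∀ n i j → matrixL n i j ≈ matrix (L ∘ suc) entries n i j
matrixL≈ n i zero    k = refl
matrixL≈ n i (suc j) k = refl

matrixC′≈ : ∀ n i j → matrixC′ n i j ≈ matrix (deriv ∘ E ∘ suc) entries n i j
-- The corner 1 is the derivative of `E 1 = X`; the derivative of `C 0` would be 0.
matrixC′≈ n zero    zero    k = sym (deriv-X k)
matrixC′≈ n (suc i) zero    k = refl
matrixC′≈ n i       (suc j) k = refl

theorem3p2 : ∀ (n : ℕ) → 1 ≤ n →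
    (deriv (C n) ≈ det (matrixL n)) × (L n ≈ det (matrixC′ n))
theorem3p2 (suc n) _ =
    (λ k → sym (trans
      (det-cong {suc n} {matrixL (suc n)} {matrix (L ∘ suc) entries (suc n)} (matrixL≈ (suc n)) k)
      (D-C≈det entries entries-lower entries-above L C⋆L n k)))
  , (λ k → sym (trans
      (det-cong {suc n} {matrixC′ (suc n)} {matrix (deriv ∘ E ∘ suc) entries (suc n)} (matrixC′≈ (suc n)) k)
      (L≈det entries entries-lower entries-above L C⋆L n k)))
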